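{- For each $\bullet\in\{\mathrm{KNT},\mathrm{MJPO}\}$, there exist integers $k$ with $2\le k\le 22$ such that $$\dim_{\mathbb F_2}\mathcal E^{\mathfrak b,\bullet}_k\;<\;2^{k-2}-d_k .$$
   Context: Multi-indices. Let $\mathbf I=\bigcup_{r\ge 0}\{(k_1,\dots,k_r)\in\mathbb N^r : k_1\ge 2\}$ with $\mathbb N=\{1,2,\dots\}$, where $r=0$ gives only the empty index $\varnothing$. The weight of $(k_1,\dots,k_r)$ is $k_1+\dots+k_r$. Let $\mathbf I_k$ be the set of elements of $\mathbf I$ of weight $k$ (empty if $k<0$). Define sets of pairs of indices $$\widehat{\mathbf{PI}}^{\mathrm{MJPO}}_k=\Bigl(\bigcup_{i+j=k,\ i,j\ge0}\mathbf I_i\times\mathbf I_j\Bigr)\cup\bigl(\{(1)\}\times\mathbf I_{k-1}\bigr),$$ $$\widehat{\mathbf{PI}}^{\mathrm{KNT}}_k=\bigl(\{(3),(2,1)\}\times\mathbf I_{k-3}\bigr)\cup\bigl(\{(2)\}\times\mathbf I_{k-2}\bigr)\cup\bigl(\{(1)\}\times\mathbf I_{k-1}\bigr).$$ Products. Let $\mathfrak H=\mathbb Q\langle x,y\rangle$ (non-commutative polynomials), $z_k=x^{k-1}y$ for $k\ge1$, $z_{\mathbf k}=z_{k_1}\cdots z_{k_r}$, $z_\varnothing=1$. Let $\mathfrak H^1=\mathbb Q+\mathfrak H y=\mathbb Q\langle z_1,z_2,\dots\rangle$ and $\mathfrak H^0=\mathbb Q+x\mathfrak H y$, the $\mathbb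 Q$-span of $\{z_{\mathbf k}:\mathbf k\in\mathbf I\}$. The shuffle product $ш$ on $\mathfrak H$ is the $\mathbb Q$-bilinear product with $w\,ш\,1=1\,ш\,w=w$ and $au\,ш\,bv=a(u\,ш\,bv)+b(au\,ш\,v)$ for letters $a,b\in\{x,y\}$ and words $u,v,w$. The stuffle product $*$ on $\mathfrak H^1$ is the $\mathbb Q$-bilinear product with $w*1=1*w=w$ and $z_iu*z_jv=z_i(u*z_jv)+z_j(z_iu*v)+z_{i+j}(u*v)$ for $i,j\ge1$ and words $u,v,w$ in the $z_n$. Regularization. Every $w\in\mathfrak H^1$ can be written uniquely as $w=\sum_{i=0}^m w_i\,ш\,y^{ш i}$ with $w_i\in\mathfrak H^0$, where $y^{ш i}$ is the $i$-th shuffle power. Define $\mathrm{reg}_ш(w)=w_0\in\mathfrak H^0$. For a pair $(\mathbf k,\mathbf l)$ in one of the sets above put $\mathsf{ds}(\mathbf k,\mathbf l)=\mathrm{reg}_ш(z_{\mathbf k}*z_{\mathbf l})-\mathrm{reg}_ш(z_{\mathbf k}\,ш\,z_{\mathbf l})$. It is known that this is a $\mathbb Z$-linear combination of the $z_{\mathbf m}$, $\mathbf m\in\mathbf I_k$. Binary spaces. Let $\mathcal H^{\mathfrak b}_k$ be the $\mathbb F_2$-vector space with basis formal symbols $\eta^{\mathfrak b}(\mathbf k)$, $\mathbf k\in\mathbf I_k$. For a $\mathbb Z$-linear combination define $\mathrm{can}^{\mathfrak b}(\sum c_{\mathbf k}z_{\mathbf k})=\sum (c_{\mathbf k}\bmod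 2)\,\eta^{\mathfrak b}(\mathbf k)$. Let $\mathcal E^{\mathfrak b,\bullet}_k\subset\mathcal H^{\mathfrak b}_k$ be the $\mathbb F_2$-span of $\{\mathrm{can}^{\mathfrak b}(\mathsf{ds}(\mathbf k,\mathbf l)) : (\mathbf k,\mathbf l)\in\widehat{\mathbf{PI}}^{\bullet}_k\}$. The integers $d_k$ are defined by $d_0=1$, $d_1=0$, $d_2=1$ and $d_k=d_{k-2}+d_{k-3}$ for $k\ge3$. -}

module Defs where

open import Algebra.Bundles using (CommutativeRing)
open import Data.Bool.Base using (if_then_else_)
open import Data.Fin.Base using (zero; toℕ)
open import Data.Integer.Base as ℤ using (∣_∣)
import Data.Integer.Properties as ℤ
open import Data.List.Base using (List; []; _∷_; [_]; _++_; map; concatMap; replicate)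
import Data.List.Properties as List
open import Data.List.Relation.Unary.All using (All)
open import Data.Nat.Base as ℕ using (ℕ; zero; suc; _+_; _∸_; _≤_; parity)
open import Data.Nat.ListAction using (sum)
import Data.Nat.Properties as ℕ
import Data.Parity.Properties as ℙ
open import Data.Product.Base using (_×_; _,_; ∃; ∃₂; Σ-syntax; map₂)
open import Data.Rational.Base using (ℚ; _/_)
import Data.Rational.Properties as ℚ
open import Data.Refinement as Refinement using (Refinement-syntax; value)
open import Data.Vec.Functional as Vector using (Vector)
open import Level using (0ℓ)
open import Relation.Binary.Definitions using (DecidableEquality)
open import Relation.Binary.PropositionalEquality.Core using (_≡_; refl)
open import Relation.Nullary.Decidable.Core using (yes; no; does)
open import Relation.Unary using (Pred)

------------------------------------------------------------------------
-- Free modules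

-- An element of the free R-module on X is a formal sum of terms (c , x),
-- in any order and possibly with repetitions; two formal sums are
-- identified when all their coefficients agree (_≈_ below).

module Free (R : CommutativeRing 0ℓ 0ℓ) where
  private module R = CommutativeRing R

  Free : Set → Set
  Free X = List (R.Carrier × X)

  𝟘 : {X : Set} → Free X
  𝟘 = []

  η : {X : Set} → X → Free X
  η x = [ (R.1# , x) ]

  infixl 6 _⊕_ _⊖_
  infixr 7 _·_

  _⊕_ : {X : Set} → Free X → Free X → Free X
  _⊕_ = _++_

  _·_ : {X : Set} → R.Carrier → Free X → Free X
  c · p = map (λ (a , x) → (c R.* a , x)) p

  _⊖_ : {X : Set} → Free X → Free X → Free X
  p ⊖ q = p ⊕ (R.- R.1#) · q

  ∑ : {X : Set} {n : ℕ} → Vector (Free X) n → Free X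
  ∑ = Vector.foldr _⊕_ 𝟘

  mapBasis : {X Y : Set} → (X → Y) → Free X → Free Y
  mapBasis f = map (map₂ f)

  bilinear : {X Y Z : Set} → (X → Y → Free Z) → Free X → Free Y → Free Z
  bilinear f p q =
    concatMap (λ (a , x) → concatMap (λ (b , y) → (a R.* b) · f x y) q) p

  module Equality {X : Set} (_≟_ : DecidableEquality X) where

    infix 4 _≈_

    coeff : Free X → X → R.Carrier
    coeff []            y = R.0#
    coeff ((c , x) ∷ p) y = (if does (x ≟ y) then c else R.0#) R.+ coeff p y

    _≈_ : Free X → Free X → Set
    p ≈ q = ∀ x → coeff p x R.≈ coeff q x

    lincomb : {n : ℕ} → Vector R.Carrier n → Vector (Free X) n → Free X
    lincomb c v = ∑ (λ i → c i · v i)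

    Span : Pred (Free X) 0ℓ → Pred (Free X) 0ℓ
    Span G p = Σ[ n ∈ ℕ ] Σ[ c ∈ Vector R.Carrier n ] Σ[ g ∈ Vector (Free X) n ]
      (∀ i → G (g i)) × p ≈ lincomb c g

    LinearlyIndependent : {n : ℕ} → Vector (Free X) n → Set
    LinearlyIndependent v = ∀ c → lincomb c v ≈ 𝟘 → ∀ i → c i R.≈ R.0#

    record IsBasis (U : Pred (Free X) 0ℓ) {n : ℕ} (b : Vector (Free X) n) : Set where
      field
        inside      : ∀ i → U (b i)
        independent : LinearlyIndependent b
        spanning    : ∀ p → U p → ∃ λ c → p ≈ lincomb c b

    HasDimension : Pred (Free X) 0ℓ → ℕ → Set
    HasDimension U n = Σ[ b ∈ Vector (Free X) n ] IsBasis U b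

module Freeℤ = Free ℤ.+-*-commutativeRing
module Freeℚ = Free ℚ.+-*-commutativeRing
module Free𝔽₂ = Free ℙ.+-*-commutativeRing

------------------------------------------------------------------------
-- Multi-indices

-- Entries of a multi-index are meant to be positive; this is enforced by
-- Admissible and holds for the literal indices (1), (2), (3), (2,1).

Index : Set
Index = List ℕ

data Admissible : Index → Set where
  ∅   : Admissible []
  _∷_ : ∀ {k ks} → 2 ≤ k → All (1 ≤_) ks → Admissible (k ∷ ks)

𝐈 : ℕ → Set
𝐈 k = [ 𝐤 ∈ Index ∣ Admissible 𝐤 × sum 𝐤 ≡ k ]

_≟ᴵ_ : {k : ℕ} → DecidableEquality (𝐈 k)
_≟ᴵ_ = Refinement._≟_ (List.≡-dec ℕ._≟_)

data Kind : Set where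
  KNT MJPO : Kind

-- The weight of the second component is tied to k by an equation rather
-- than by k ∸ n, so that 𝐈_{k-n} is empty for k < n.

data PI-MJPO (k : ℕ) : Index → Index → Set where
  adm : ∀ {i j} (𝐤 : 𝐈 i) (𝐥 : 𝐈 j) → i + j ≡ k → PI-MJPO k (value 𝐤) (value 𝐥)
  [1] : ∀ {j} (𝐥 : 𝐈 j) → 1 + j ≡ k → PI-MJPO k (1 ∷ []) (value 𝐥)

data PI-KNT (k : ℕ) : Index → Index → Set where
  [3]   : ∀ {j} (𝐥 : 𝐈 j) → 3 + j ≡ k → PI-KNT k (3 ∷ []) (value 𝐥)
  [2,1] : ∀ {j} (𝐥 : 𝐈 j) → 3 + j ≡ k → PI-KNT k (2 ∷ 1 ∷ []) (value 𝐥)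
  [2]   : ∀ {j} (𝐥 : 𝐈 j) → 2 + j ≡ k → PI-KNT k (2 ∷ []) (value 𝐥)
  [1]   : ∀ {j} (𝐥 : 𝐈 j) → 1 + j ≡ k → PI-KNT k (1 ∷ []) (value 𝐥)

PI : Kind → ℕ → Index → Index → Set
PI KNT  = PI-KNT
PI MJPO = PI-MJPO

------------------------------------------------------------------------
-- The algebra ℚ⟨x,y⟩ and the two products

data Letter : Set where
  x y : Letter

_≟ᴸ_ : DecidableEquality Letter
x ≟ᴸ x = yes refl
x ≟ᴸ y = no λ ()
y ≟ᴸ x = no λ ()
y ≟ᴸ y = yes refl

Word : Set
Word = List Letter

open Freeℚ
open Freeℚ.Equality (List.≡-dec _≟ᴸ_) using (_≈_)

𝔥 : Set
𝔥 = Free Word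

-- 𝔥¹ as the free algebra ℚ⟨z₁,z₂,…⟩, with the word z_{k₁}⋯z_{kᵣ} written as
-- the list of its subscripts.

𝔥¹ : Set
𝔥¹ = Free Index

z : ℕ → Word
z k = replicate (k ∸ 1) x ++ [ y ]

zʷ : Index → Word
zʷ = concatMap z

ι : 𝔥¹ → 𝔥
ι = mapBasis zʷ

infixl 7 _ш_ _шʷ_ _∗_ _∗ʷ_

_шʷ_ : Word → Word → 𝔥
[]      шʷ v       = η v
(a ∷ u) шʷ []      = η (a ∷ u)
(a ∷ u) шʷ (b ∷ v) = mapBasis (a ∷_) (u шʷ (b ∷ v)) ⊕ mapBasis (b ∷_) ((a ∷ u) шʷ v)

_ш_ : 𝔥 → 𝔥 → 𝔥
_ш_ = bilinear _шʷ_

_∗ʷ_ : Index → Index → 𝔥¹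
[]      ∗ʷ v       = η v
(i ∷ u) ∗ʷ []      = η (i ∷ u)
(i ∷ u) ∗ʷ (j ∷ v) =
    mapBasis (i ∷_)     (u ∗ʷ (j ∷ v))
  ⊕ mapBasis (j ∷_)     ((i ∷ u) ∗ʷ v)
  ⊕ mapBasis (i + j ∷_) (u ∗ʷ v)

_∗_ : 𝔥¹ → 𝔥¹ → 𝔥¹
_∗_ = bilinear _∗ʷ_

------------------------------------------------------------------------
-- Regularization

-- 𝔥⁰ = ℚ + x𝔥y
𝔥⁰ : Pred 𝔥 0ℓ
𝔥⁰ w = Σ[ c ∈ ℚ ] Σ[ u ∈ 𝔥 ] w ≈ c · η [] ⊕ mapBasis (λ v → x ∷ v ++ [ y ]) u

yш^_ : ℕ → 𝔥
yш^ zero  = η []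
yш^ suc n = η [ y ] ш yш^ n

-- The graph of reg_ш: IsReg w v says that v is the coefficient w₀ in a
-- decomposition w = ∑ᵢ wᵢ ш y^{ш i} with all wᵢ in 𝔥⁰.  Such a decomposition
-- exists for w in 𝔥¹ and is unique.
IsReg : 𝔥 → 𝔥 → Set
IsReg w v = Σ[ m ∈ ℕ ] Σ[ ws ∈ Vector 𝔥 (suc m) ]
  (∀ i → 𝔥⁰ (ws i)) × w ≈ ∑ (λ i → ws i ш yш^ toℕ i) × v ≈ ws zero

-- The graph of ds: IsDs 𝐤 𝐥 d says that d = ds(𝐤,𝐥).
IsDs : Index → Index → 𝔥 → Set
IsDs 𝐤 𝐥 d = ∃₂ λ v w →
    IsReg (ι (η 𝐤 ∗ η 𝐥)) v
  × IsReg (η (zʷ 𝐤) ш η (zʷ 𝐥)) w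
  × d ≈ v ⊖ w

------------------------------------------------------------------------
-- Binary spaces

-- The integral combination ∑ c_𝐦 z_𝐦 as an element of 𝔥.
⟦_⟧ : {k : ℕ} → Freeℤ.Free (𝐈 k) → 𝔥
⟦_⟧ = map λ (c , 𝐦) → (c / 1 , zʷ (value 𝐦))

𝓗ᵇ : ℕ → Set
𝓗ᵇ k = Free𝔽₂.Free (𝐈 k)

module Linear𝓗ᵇ (k : ℕ) = Free𝔽₂.Equality {X = 𝐈 k} _≟ᴵ_

canᵇ : {k : ℕ} → Freeℤ.Free (𝐈 k) → 𝓗ᵇ k
canᵇ = map λ (c , 𝐦) → (parity ∣ c ∣ , 𝐦)

data Generator (• : Kind) (k : ℕ) : Pred (𝓗ᵇ k) 0ℓ where
  generator : ∀ {𝐤 𝐥} → PI • k 𝐤 𝐥 →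
              (d : Freeℤ.Free (𝐈 k)) → IsDs 𝐤 𝐥 ⟦ d ⟧ →
              Generator • k (canᵇ d)

𝓔ᵇ : Kind → (k : ℕ) → Pred (𝓗ᵇ k) 0ℓ
𝓔ᵇ • k = Linear𝓗ᵇ.Span k (Generator • k)

dim𝓔ᵇ_,_≡_ : Kind → ℕ → ℕ → Set
dim𝓔ᵇ • , k ≡ n = Linear𝓗ᵇ.HasDimension k (𝓔ᵇ • k) n

------------------------------------------------------------------------

d : ℕ → ℕ
d 0                   = 1
d 1                   = 0
d 2                   = 1
d (suc (suc (suc k))) = d (suc k) + d k

{-# OPTIONS --safe #-}
module Submission where

-- Weight 7 works for both kinds.  Deleting a leading y is a derivation of the
-- shuffle algebra which vanishes on 𝔥⁰ and sends y^{ш n} to n y^{ш (n-1)}; hence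
-- the coefficients of a decomposition ∑ wᵢ ш y^{ш i} are unique, and every
-- ds(𝐤,𝐥) equals z_𝐤 ∗ z_𝐥 − z_𝐤 ш z_𝐥.  In weight 7 all of these are annihilated
-- modulo 2 by four linearly independent functionals on the 32-dimensional
-- space 𝓗ᵇ₇, so that dim 𝓔ᵇ₇ ≤ 28 < 29 = 2⁵ − d₇.
open import Defs
open import Algebra.Bundles using (CommutativeRing)
open import Data.Bool.Base using (if_then_else_)
open import Data.Empty using (⊥)
open import Data.Fin.Base using (Fin; zero; suc; toℕ; combine; finToFun; funToFin)
import Data.Fin.Properties as Fin
open import Data.Integer.Base as ℤ using (ℤ; ∣_∣; -[1+_])
import Data.Integer.Properties as ℤ
open import Data.Irrelevant using () renaming ([_] to irr)
open import Data.List.Base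
  using (List; []; _∷_; [_]; _++_; map; concatMap; foldr; length; lookup; drop; upTo;
         cartesianProduct)
import Data.List.Properties as List
open import Data.List.Membership.Propositional using (_∈_; find)
open import Data.List.Membership.Propositional.Properties
  using (∈-map⁺; ∈-++⁺ˡ; ∈-++⁺ʳ; ∈-upTo⁺; ∈-upTo⁻; ∈-concatMap⁺; ∈-concatMap⁻;
         ∈-cartesianProduct⁺; ∈-cartesianProduct⁻)
open import Data.List.Relation.Binary.Permutation.Propositional as ↭ using (_↭_; ↭-refl; ↭-trans)
import Data.List.Relation.Binary.Permutation.Propositional.Properties as ↭
open import Data.List.Relation.Unary.All as All using (All; []; _∷_)
import Data.List.Relation.Unary.All.Properties as All
open import Data.List.Relation.Unary.Any as Any using (Any; here; there)
import Data.List.Relation.Unary.Any.Properties as Any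
open import Data.Nat.Base as ℕ using (ℕ; zero; suc; _≤_; _^_; _∸_; z≤n; s≤s; parity)
import Data.Nat.Coprimality as Coprimality
open import Data.Nat.ListAction using (sum)
import Data.Nat.Properties as ℕ
open import Data.Parity.Base as ℙ using (Parity; 0ℙ; 1ℙ)
import Data.Parity.Properties as ℙ
open import Data.Product.Base using (_×_; _,_; ∃; ∃-syntax; proj₁; proj₂; uncurry)
open import Data.Rational.Base as ℚ using (ℚ; mkℚ; 0ℚ; 1ℚ; _/_)
import Data.Rational.Properties as ℚ
open import Data.Rational.Solver using (module +-*-Solver)
open import Data.Refinement using (value; _,_; value-injective)
open import Data.Unit.Base using (tt)
open import Data.Vec.Functional as Vector using (Vector)
open import Function.Base using (_∘_)
open import Function.Definitions using (Injective)
open import Level using (0ℓ)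
open import Relation.Binary.Definitions using (DecidableEquality)
open import Relation.Binary.PropositionalEquality as ≡ using (_≡_)
open import Relation.Nullary.Decidable
  using (Dec; yes; no; does; True; toWitness; map′; recompute; _×-dec_)
open import Relation.Nullary.Negation using (¬_; contradiction)

-- Linear functionals on free modules

-- The fourth functional, one more than `d 7` = 3, is what makes the inequality strict. One of the
-- four has a conceptual origin: weight 7 = 2³ - 1 makes every binomial coefficient C(7,i) odd, and
-- the number of stuffle terms of two indices is a Delannoy number, always odd, so the all-ones
-- functional `φ₀` kills every difference. The other three are certified by evaluation on the
-- finitely many pairs.
--
-- Two obstacles shape the rest. `IsDs` and `Generator` quantify over arbitrary decompositions and
-- arbitrary integral representatives, so before anything can be computed, uniqueness has to be
-- proved over ℚ and carried through ℤ to 𝔽₂; hence the stress on quantities that depend on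
-- coefficients alone. And `HasDimension` asks for an actual basis: one is selected from a finite
-- list of generators by a decidable span test, its size stays an unknown, and that size is bounded
-- by adjoining four basis vectors which the functionals separate from the span.

module Pairing (R : CommutativeRing 0ℓ 0ℓ) where
  open CommutativeRing R hiding (zero)
  open Free R
  open import Algebra.Properties.Ring ring using (-1*x≈-x)
  open import Algebra.Properties.AbelianGroup +-abelianGroup using (x∙y⁻¹≈ε⇒x≈y)
  open import Algebra.Properties.CommutativeSemigroup +-commutativeSemigroup
    using (interchange; x∙yz≈y∙xz)
  open import Algebra.Properties.CommutativeSemigroup *-commutativeSemigroup
    using () renaming (x∙yz≈y∙xz to x*yz≈y*xz)
  open import Relation.Binary.Reasoning.Setoid setoid

  private variable
    X Y Z : Set

  -- Evaluated on the representing list, so that linearity is an induction over terms; independence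
  -- of the representative is the separate fact `pair-≈`.
  ⟪_∣_⟫ : (X → Carrier) → Free X → Carrier
  ⟪ f ∣ [] ⟫          = 0#
  ⟪ f ∣ (c , s) ∷ p ⟫ = c * f s + ⟪ f ∣ p ⟫

  pair-cong : {f g : X → Carrier} → (∀ s → f s ≈ g s) → ∀ p → ⟪ f ∣ p ⟫ ≈ ⟪ g ∣ p ⟫
  pair-cong f≈g []            = refl
  pair-cong f≈g ((c , s) ∷ p) = +-cong (*-congˡ (f≈g s)) (pair-cong f≈g p)

  pair-⊕ : (f : X → Carrier) → ∀ p q → ⟪ f ∣ p ⊕ q ⟫ ≈ ⟪ f ∣ p ⟫ + ⟪ f ∣ q ⟫
  pair-⊕ f []            q = sym (+-identityˡ _)
  pair-⊕ f ((c , s) ∷ p) q = trans (+-congˡ (pair-⊕ f p q)) (sym (+-assoc _ _ _))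

  pair-· : (f : X → Carrier) → ∀ c p → ⟪ f ∣ c · p ⟫ ≈ c * ⟪ f ∣ p ⟫
  pair-· f c []            = sym (zeroʳ c)
  pair-· f c ((a , s) ∷ p) =
    trans (+-cong (*-assoc c a (f s)) (pair-· f c p)) (sym (distribˡ c _ _))

  pair-⊖ : (f : X → Carrier) → ∀ p q → ⟪ f ∣ p ⊖ q ⟫ ≈ ⟪ f ∣ p ⟫ - ⟪ f ∣ q ⟫
  pair-⊖ f p q = trans (pair-⊕ f p _) (+-congˡ (trans (pair-· f (- 1#) q) (-1*x≈-x _)))

  pair-η : (f : X → Carrier) → ∀ s → ⟪ f ∣ η s ⟫ ≈ f s
  pair-η f s = trans (+-identityʳ _) (*-identityˡ _)

  pair-mapBasis : (f : Y → Carrier) (g : X → Y) → ∀ p → ⟪ f ∣ mapBasis g p ⟫ ≈ ⟪ f ∘ g ∣ p ⟫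
  pair-mapBasis f g []            = refl
  pair-mapBasis f g ((c , s) ∷ p) = +-congˡ (pair-mapBasis f g p)

  pair-+ : (f g : X → Carrier) → ∀ p → ⟪ (λ s → f s + g s) ∣ p ⟫ ≈ ⟪ f ∣ p ⟫ + ⟪ g ∣ p ⟫
  pair-+ f g []            = sym (+-identityˡ _)
  pair-+ f g ((c , s) ∷ p) =
    trans (+-cong (distribˡ c _ _) (pair-+ f g p)) (interchange _ _ _ _)

  pair-* : ∀ a (f : X → Carrier) p → ⟪ (λ s → a * f s) ∣ p ⟫ ≈ a * ⟪ f ∣ p ⟫
  pair-* a f []            = sym (zeroʳ a)
  pair-* a f ((c , s) ∷ p) =
    trans (+-cong (x*yz≈y*xz c a _) (pair-* a f p)) (sym (distribˡ a _ _))

  pair-0 : (p : Free X) → ⟪ (λ _ → 0#) ∣ p ⟫ ≈ 0#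
  pair-0 []            = refl
  pair-0 ((c , s) ∷ p) = trans (+-cong (zeroʳ c) (pair-0 p)) (+-identityˡ _)

  -- Turns a question about a product of formal sums into one about products of basis elements,
  -- nested inside two pairings.
  pair-bilinear : (f : Z → Carrier) (g : X → Y → Free Z) → ∀ p q →
    ⟪ f ∣ bilinear g p q ⟫ ≈ ⟪ (λ s → ⟪ (λ t → ⟪ f ∣ g s t ⟫) ∣ q ⟫) ∣ p ⟫
  pair-bilinear {Z} {X} {Y} f g p q = outer p
    where
    row : Carrier → _ → Free _ → Free _
    row a s = concatMap (λ (b , t) → (a * b) · g s t)

    inner : ∀ a s q → ⟪ f ∣ row a s q ⟫ ≈ a * ⟪ (λ t → ⟪ f ∣ g s t ⟫) ∣ q ⟫
    inner a s []            = sym (zeroʳ a)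
    inner a s ((b , t) ∷ q) = begin
      ⟪ f ∣ (a * b) · g s t ⊕ row a s q ⟫
        ≈⟨ pair-⊕ f ((a * b) · g s t) (row a s q) ⟩
      ⟪ f ∣ (a * b) · g s t ⟫ + ⟪ f ∣ row a s q ⟫
        ≈⟨ +-cong (trans (pair-· f (a * b) (g s t)) (*-assoc a b _)) (inner a s q) ⟩
      a * (b * ⟪ f ∣ g s t ⟫) + a * ⟪ _ ∣ q ⟫
        ≈⟨ distribˡ a _ _ ⟨
      a * (b * ⟪ f ∣ g s t ⟫ + ⟪ _ ∣ q ⟫) ∎

    outer : ∀ p → ⟪ f ∣ bilinear g p q ⟫ ≈ ⟪ (λ s → ⟪ (λ t → ⟪ f ∣ g s t ⟫) ∣ q ⟫) ∣ p ⟫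
    outer []            = refl
    outer ((a , s) ∷ p) = trans (pair-⊕ f (row a s q) (bilinear g p q))
                                (+-cong (inner a s q) (outer p))

  pair-bilinear-η : (f : Z → Carrier) (g : X → Y → Free Z) → ∀ s t →
    ⟪ f ∣ bilinear g (η s) (η t) ⟫ ≈ ⟪ f ∣ g s t ⟫
  pair-bilinear-η f g s t = trans (pair-bilinear f g (η s) (η t))
    (trans (pair-η (λ s → ⟪ (λ t → ⟪ f ∣ g s t ⟫) ∣ η t ⟫) s) (pair-η (λ t → ⟪ f ∣ g s t ⟫) t))

  -- Coefficients are recorded as multiplicities in the list.
  formal : List X → Free X
  formal = map (1# ,_)

  formal-++ : (L M : List X) → formal (L ++ M) ≡ formal L ⊕ formal M
  formal-++ = List.map-++ (1# ,_)

  formal-map : (f : X → Y) (L : List X) → mapBasis f (formal L) ≡ formal (map f L)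
  formal-map f []      = ≡.refl
  formal-map f (s ∷ L) = ≡.cong ((1# , f s) ∷_) (formal-map f L)

  module Coeff {X : Set} (_≟_ : DecidableEquality X) where
    open Equality _≟_ renaming (_≈_ to _≋_)

    δ : X → X → Carrier
    δ t s = if does (s ≟ t) then 1# else 0#

    coeff≈pair : ∀ p t → coeff p t ≈ ⟪ δ t ∣ p ⟫
    coeff≈pair []            t = refl
    coeff≈pair ((c , s) ∷ p) t with s ≟ t
    ... | yes _ = +-cong (sym (*-identityʳ c)) (coeff≈pair p t)
    ... | no  _ = +-cong (sym (zeroʳ c)) (coeff≈pair p t)

    -- A pairing depends only on the coefficients because a basis element can be
    -- collected into one term and split off.
    remove : X → Free X → Free X
    remove t []            = []
    remove t ((c , s) ∷ p) = if does (s ≟ t) then remove t p else (c , s) ∷ remove t p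

    pair-remove : (f : X → Carrier) → ∀ t p → ⟪ f ∣ p ⟫ ≈ coeff p t * f t + ⟪ f ∣ remove t p ⟫
    pair-remove f t [] = sym (trans (+-identityʳ _) (zeroˡ _))
    pair-remove f t ((c , s) ∷ p) with s ≟ t
    ... | yes ≡.refl = begin
      c * f t + ⟪ f ∣ p ⟫                                   ≈⟨ +-congˡ (pair-remove f t p) ⟩
      c * f t + (coeff p t * f t + ⟪ f ∣ remove t p ⟫)      ≈⟨ +-assoc _ _ _ ⟨
      (c * f t + coeff p t * f t) + ⟪ f ∣ remove t p ⟫      ≈⟨ +-congʳ (distribʳ (f t) c _) ⟨
      (c + coeff p t) * f t + ⟪ f ∣ remove t p ⟫            ∎
    ... | no _ = begin
      c * f s + ⟪ f ∣ p ⟫                                   ≈⟨ +-congˡ (pair-remove f t p) ⟩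
      c * f s + (coeff p t * f t + ⟪ f ∣ remove t p ⟫)      ≈⟨ x∙yz≈y∙xz _ _ _ ⟩
      coeff p t * f t + (c * f s + ⟪ f ∣ remove t p ⟫)      ≈⟨ +-congʳ (*-congʳ (+-identityˡ _)) ⟨
      (0# + coeff p t) * f t + (c * f s + ⟪ f ∣ remove t p ⟫) ∎

    length-remove : ∀ t p → length (remove t p) ℕ.≤ length p
    length-remove t []            = z≤n
    length-remove t ((c , s) ∷ p) with s ≟ t
    ... | yes _ = ℕ.m≤n⇒m≤1+n (length-remove t p)
    ... | no  _ = s≤s (length-remove t p)

    remove-𝟘 : ∀ {p} t → p ≋ 𝟘 → remove t p ≋ 𝟘
    remove-𝟘 {p} t p≋𝟘 r = begin
      coeff (remove t p) r                    ≈⟨ coeff≈pair (remove t p) r ⟩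
      ⟪ δ r ∣ remove t p ⟫                    ≈⟨ +-identityˡ _ ⟨
      0# + ⟪ δ r ∣ remove t p ⟫               ≈⟨ +-congʳ (trans (*-congʳ (p≋𝟘 t)) (zeroˡ _)) ⟨
      coeff p t * δ r t + ⟪ δ r ∣ remove t p ⟫ ≈⟨ pair-remove (δ r) t p ⟨
      ⟪ δ r ∣ p ⟫                             ≈⟨ coeff≈pair p r ⟨
      coeff p r                               ≈⟨ p≋𝟘 r ⟩
      0#                                      ∎

    -- Collecting all terms at the leading basis element `s` contributes `coeff p s`, hence zero,
    -- and leaves a shorter sum. That sum is no structural part of `p`, so the recursion runs on the
    -- length bound `n`.
    pair-𝟘 : (f : X → Carrier) → ∀ n p → length p ℕ.≤ n → p ≋ 𝟘 → ⟪ f ∣ p ⟫ ≈ 0#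
    pair-𝟘 f n       []             _         _   = refl
    pair-𝟘 f (suc n) p@((c , s) ∷ p′) (s≤s p′≤n) p≋𝟘 = begin
      ⟪ f ∣ p ⟫                              ≈⟨ pair-remove f s p ⟩
      coeff p s * f s + ⟪ f ∣ remove s p ⟫
        ≈⟨ +-cong (trans (*-congʳ (p≋𝟘 s)) (zeroˡ _))
                  (pair-𝟘 f n (remove s p) shorter (remove-𝟘 {p} s p≋𝟘)) ⟩
      0# + 0#                                ≈⟨ +-identityˡ _ ⟩
      0#                                     ∎
      where
      shorter : length (remove s p) ℕ.≤ n
      shorter with s ≟ s
      ... | yes _  = ℕ.≤-trans (length-remove s p′) p′≤n
      ... | no s≢s = contradiction ≡.refl s≢s

    coeff-⊕ : ∀ p q t → coeff (p ⊕ q) t ≈ coeff p t + coeff q t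
    coeff-⊕ p q t = begin
      coeff (p ⊕ q) t                ≈⟨ coeff≈pair (p ⊕ q) t ⟩
      ⟪ δ t ∣ p ⊕ q ⟫                ≈⟨ pair-⊕ (δ t) p q ⟩
      ⟪ δ t ∣ p ⟫ + ⟪ δ t ∣ q ⟫      ≈⟨ +-cong (coeff≈pair p t) (coeff≈pair q t) ⟨
      coeff p t + coeff q t          ∎

    coeff-· : ∀ c p t → coeff (c · p) t ≈ c * coeff p t
    coeff-· c p t = trans (coeff≈pair (c · p) t)
      (trans (pair-· (δ t) c p) (*-congˡ (sym (coeff≈pair p t))))

    coeff-⊖ : ∀ p q t → coeff (p ⊖ q) t ≈ coeff p t - coeff q t
    coeff-⊖ p q t = trans (coeff-⊕ p _ t) (+-congˡ (trans (coeff-· (- 1#) q t) (-1*x≈-x _)))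

    pair-≈ : (f : X → Carrier) → ∀ {p q} → p ≋ q → ⟪ f ∣ p ⟫ ≈ ⟪ f ∣ q ⟫
    pair-≈ f {p} {q} p≋q = x∙y⁻¹≈ε⇒x≈y _ _ (trans (sym (pair-⊖ f p q))
      (pair-𝟘 f _ (p ⊖ q) ℕ.≤-refl λ r →
        trans (coeff-⊖ p q r) (trans (+-congʳ (p≋q r)) (-‿inverseʳ _))))

open ≡ using (refl; sym; trans; cong; cong₂; subst; module ≡-Reasoning)
open import Data.Nat.Base using (_+_)

-- Additivity of `h` lets it commute with collecting terms, and injectivity of `f` keeps distinct
-- basis elements from being collected together. It serves both for the embedding of ℤ into ℚ and
-- for reduction modulo 2.
coeff-transfer : (R S : CommutativeRing 0ℓ 0ℓ) →
  let module R = CommutativeRing R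
      module S = CommutativeRing S
      open Free.Equality R renaming (coeff to coeffᴿ)
      open Free.Equality S renaming (coeff to coeffˢ)
  in
  (h : R.Carrier → S.Carrier) →
  h R.0# S.≈ S.0# → (∀ a b → h (a R.+ b) S.≈ h a S.+ h b) →
  {X Y : Set} (_≟X_ : DecidableEquality X) (_≟Y_ : DecidableEquality Y) →
  (f : X → Y) → Injective _≡_ _≡_ f →
  ∀ p s → coeffˢ _≟Y_ (map (λ (c , t) → h c , f t) p) (f s) S.≈ h (coeffᴿ _≟X_ p s)
coeff-transfer R S h h-0 h-+ _≟X_ _≟Y_ f f-inj = go
  where
  module R = CommutativeRing R
  module S = CommutativeRing S
  open Free.Equality R _≟X_ using () renaming (coeff to coeffᴿ)
  open Free.Equality S _≟Y_ using () renaming (coeff to coeffˢ)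

  go : ∀ p s → coeffˢ (map (λ (c , t) → h c , f t) p) (f s) S.≈ h (coeffᴿ p s)
  go []            s = S.sym h-0
  go ((c , t) ∷ p) s with t ≟X s | f t ≟Y f s
  ... | yes _   | yes _     = S.trans (S.+-congˡ (go p s)) (S.sym (h-+ c _))
  ... | no _    | no _      = S.trans (S.+-cong (S.sym h-0) (go p s)) (S.sym (h-+ R.0# _))
  ... | yes t≡s | no ft≢fs  = contradiction (cong f t≡s) ft≢fs
  ... | no t≢s  | yes ft≡fs = contradiction (f-inj ft≡fs) t≢s

-- Vector spaces over 𝔽₂

p+q≡0⇒p≡q : ∀ p q → p ℙ.+ q ≡ 0ℙ → p ≡ q
p+q≡0⇒p≡q 0ℙ 0ℙ _ = refl
p+q≡0⇒p≡q 1ℙ 1ℙ _ = refl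

p≡q+r⇒p+q≡r : ∀ {p} q {r} → p ≡ q ℙ.+ r → p ℙ.+ q ≡ r
p≡q+r⇒p+q≡r 0ℙ refl = ℙ.+-identityʳ _
p≡q+r⇒p+q≡r 1ℙ {0ℙ} refl = refl
p≡q+r⇒p+q≡r 1ℙ {1ℙ} refl = refl

p+q≡r⇒p≡q+r : ∀ {p} q {r} → p ℙ.+ q ≡ r → p ≡ q ℙ.+ r
p+q≡r⇒p≡q+r {0ℙ} 0ℙ refl = refl
p+q≡r⇒p≡q+r {0ℙ} 1ℙ refl = refl
p+q≡r⇒p≡q+r {1ℙ} 0ℙ refl = refl
p+q≡r⇒p≡q+r {1ℙ} 1ℙ refl = refl

-- Parities as binary digits, so that `finToFun` and `funToFin` can count vectors over 𝔽₂.
bit : Parity → Fin 2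
bit 0ℙ = zero
bit 1ℙ = suc zero

unbit : Fin 2 → Parity
unbit zero       = 0ℙ
unbit (suc zero) = 1ℙ

unbit-bit : ∀ p → unbit (bit p) ≡ p
unbit-bit 0ℙ = refl
unbit-bit 1ℙ = refl

bit-unbit : ∀ i → bit (unbit i) ≡ i
bit-unbit zero       = refl
bit-unbit (suc zero) = refl

funToFin-cong : ∀ {m n} {f g : Fin m → Fin n} → (∀ i → f i ≡ g i) → funToFin f ≡ funToFin g
funToFin-cong {zero}  f≗g = refl
funToFin-cong {suc m} f≗g = cong₂ combine (f≗g zero) (funToFin-cong (f≗g ∘ suc))

module FiniteDimensional
  {X : Set} (_≟_ : DecidableEquality X) (xs : List X) (xs-complete : ∀ s → s ∈ xs) where
  open Free𝔽₂
  open Free𝔽₂.Equality _≟_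
  open Pairing ℙ.+-*-commutativeRing
  open Coeff _≟_
  open ≡-Reasoning

  InSpan : ∀ {n} → Vector (Free X) n → Free X → Set
  InSpan b p = ∃ λ c → p ≈ lincomb c b

  lincomb-∷ : ∀ {n} (c : Vector Parity (suc n)) b s →
    coeff (lincomb c b) s ≡ c zero ℙ.* coeff (b zero) s ℙ.+ coeff (lincomb (c ∘ suc) (b ∘ suc)) s
  lincomb-∷ c b s = trans (coeff-⊕ (c zero · b zero) _ s)
    (cong (ℙ._+ coeff (lincomb (c ∘ suc) (b ∘ suc)) s) (coeff-· (c zero) (b zero) s))

  lincomb-zero : ∀ {n} (b : Vector (Free X) n) s → coeff (lincomb (λ _ → 0ℙ) b) s ≡ 0ℙ
  lincomb-zero {zero}  b s = refl
  lincomb-zero {suc n} b s = trans (lincomb-∷ (λ _ → 0ℙ) b s) (lincomb-zero (b ∘ suc) s)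

  lincomb-+ : ∀ {n} (c c′ : Vector Parity n) b s →
    coeff (lincomb (λ i → c i ℙ.+ c′ i) b) s ≡ coeff (lincomb c b) s ℙ.+ coeff (lincomb c′ b) s
  lincomb-+ {zero}  c c′ b s = refl
  lincomb-+ {suc n} c c′ b s = begin
    coeff (lincomb (λ i → c i ℙ.+ c′ i) b) s
      ≡⟨ lincomb-∷ (λ i → c i ℙ.+ c′ i) b s ⟩
    (c zero ℙ.+ c′ zero) ℙ.* B ℙ.+ coeff (lincomb (λ i → c (suc i) ℙ.+ c′ (suc i)) (b ∘ suc)) s
      ≡⟨ cong₂ ℙ._+_ (ℙ.*-distribʳ-+ B (c zero) (c′ zero))
                     (lincomb-+ (c ∘ suc) (c′ ∘ suc) (b ∘ suc) s) ⟩
    (c zero ℙ.* B ℙ.+ (c′ zero ℙ.* B)) ℙ.+ (L ℙ.+ L′)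
      ≡⟨ interchange (c zero ℙ.* B) (c′ zero ℙ.* B) L L′ ⟩
    (c zero ℙ.* B ℙ.+ L) ℙ.+ (c′ zero ℙ.* B ℙ.+ L′)
      ≡⟨ cong₂ ℙ._+_ (lincomb-∷ c b s) (lincomb-∷ c′ b s) ⟨
    coeff (lincomb c b) s ℙ.+ coeff (lincomb c′ b) s ∎
    where
    open import Algebra.Properties.CommutativeSemigroup ℙ.+-commutativeSemigroup using (interchange)
    B L L′ : Parity
    B  = coeff (b zero) s
    L  = coeff (lincomb (c ∘ suc) (b ∘ suc)) s
    L′ = coeff (lincomb (c′ ∘ suc) (b ∘ suc)) s

  lincomb-* : ∀ {n} a (c : Vector Parity n) b s →
    coeff (lincomb (λ i → a ℙ.* c i) b) s ≡ a ℙ.* coeff (lincomb c b) s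
  lincomb-* 0ℙ c b s = lincomb-zero b s
  lincomb-* 1ℙ c b s = refl

  inSpan-lincomb : ∀ {m n} {b : Vector (Free X) n} (c : Vector Parity m) (g : Vector (Free X) m) →
    (∀ i → InSpan b (g i)) → InSpan b (lincomb c g)
  inSpan-lincomb {zero}  {b = b} c g g∈ = (λ _ → 0ℙ) , λ s → sym (lincomb-zero b s)
  inSpan-lincomb {suc m} {b = b} c g g∈ with g∈ zero | inSpan-lincomb (c ∘ suc) (g ∘ suc) (g∈ ∘ suc)
  ... | a , g₀≈ | a′ , rest≈ = (λ i → c zero ℙ.* a i ℙ.+ a′ i) , λ s → begin
    coeff (lincomb c g) s
      ≡⟨ lincomb-∷ c g s ⟩
    c zero ℙ.* coeff (g zero) s ℙ.+ coeff (lincomb (c ∘ suc) (g ∘ suc)) s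
      ≡⟨ cong₂ ℙ._+_ (trans (cong (c zero ℙ.*_) (g₀≈ s)) (sym (lincomb-* (c zero) a b s))) (rest≈ s) ⟩
    coeff (lincomb (λ i → c zero ℙ.* a i) b) s ℙ.+ coeff (lincomb a′ b) s
      ≡⟨ lincomb-+ (λ i → c zero ℙ.* a i) a′ b s ⟨
    coeff (lincomb (λ i → c zero ℙ.* a i ℙ.+ a′ i) b) s ∎

  ≈-dec : ∀ p q → Dec (p ≈ q)
  ≈-dec p q = map′ (λ p≈q s → All.lookup p≈q (xs-complete s)) (λ p≈q → All.tabulate λ {s} _ → p≈q s)
    (All.all? (λ s → coeff p s ℙ.≟ coeff q s) xs)

  inSpan-∷ : ∀ {n} {b : Vector (Free X) n} {p} g → InSpan b p → InSpan (g Vector.∷ b) p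
  inSpan-∷ {b = b} g (c , p≈) =
    0ℙ Vector.∷ c , λ s → trans (p≈ s) (sym (lincomb-∷ (0ℙ Vector.∷ c) (g Vector.∷ b) s))

  -- The coefficient of the first vector is 0 or 1, so `p` lies in the span exactly when `p` or
  -- `p ⊕ b zero` lies in the span of the remaining vectors.
  inSpan? : ∀ {n} (b : Vector (Free X) n) p → Dec (InSpan b p)
  inSpan? {zero}  b p = map′ ((λ ()) ,_) proj₂ (≈-dec p 𝟘)
  inSpan? {suc n} b p with inSpan? (b ∘ suc) p | inSpan? (b ∘ suc) (p ⊕ b zero)
  ... | yes (c , p≈) | _ = yes (0ℙ Vector.∷ c , λ s →
    trans (p≈ s) (sym (lincomb-∷ (0ℙ Vector.∷ c) b s)))
  ... | no _ | yes (c , p+b≈) = yes (1ℙ Vector.∷ c , λ s →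
    trans (p+q≡r⇒p≡q+r (coeff (b zero) s) (trans (sym (coeff-⊕ p (b zero) s)) (p+b≈ s)))
          (sym (lincomb-∷ (1ℙ Vector.∷ c) b s)))
  ... | no p∉ | no p+b∉ = no absurd
    where
    absurd : ¬ InSpan b p
    absurd (c , p≈) = case (c zero) refl
      where
      p≡ : ∀ {a} → c zero ≡ a → ∀ s →
        coeff p s ≡ a ℙ.* coeff (b zero) s ℙ.+ coeff (lincomb (c ∘ suc) (b ∘ suc)) s
      p≡ refl s = trans (p≈ s) (lincomb-∷ c b s)

      case : ∀ a → c zero ≡ a → ⊥
      case 0ℙ c₀≡0 = p∉ (c ∘ suc , p≡ c₀≡0)
      case 1ℙ c₀≡1 = p+b∉ (c ∘ suc , λ s →
        trans (coeff-⊕ p (b zero) s) (p≡q+r⇒p+q≡r (coeff (b zero) s) (p≡ c₀≡1 s)))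

  -- A relation in which `g` has coefficient 1 would, as signs vanish in characteristic 2, express
  -- `g` through `b`.
  independent-∷ : ∀ {n} {b : Vector (Free X) n} {g} →
    LinearlyIndependent b → ¬ InSpan b g → LinearlyIndependent (g Vector.∷ b)
  independent-∷ {b = b} {g} b-indep g∉ c c≈𝟘 = case (c zero) refl
    where
    0≡ : ∀ {a} → c zero ≡ a → ∀ s → a ℙ.* coeff g s ℙ.+ coeff (lincomb (c ∘ suc) b) s ≡ 0ℙ
    0≡ refl s = trans (sym (lincomb-∷ c (g Vector.∷ b) s)) (c≈𝟘 s)

    case : ∀ a → c zero ≡ a → ∀ i → c i ≡ 0ℙ
    case 0ℙ c₀≡0 zero    = c₀≡0
    case 0ℙ c₀≡0 (suc i) = b-indep (c ∘ suc) (0≡ c₀≡0) i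
    case 1ℙ c₀≡1 i       = contradiction (c ∘ suc , λ s → p+q≡0⇒p≡q _ _ (0≡ c₀≡1 s)) g∉

  -- The field `⊆gs` is what later hands properties of generators, such as being annihilated by a
  -- functional, on to the basis vectors.
  record Subbasis (gs : List (Free X)) : Set where
    field
      {size}      : ℕ
      basis       : Vector (Free X) size
      ⊆gs         : ∀ i → basis i ∈ gs
      independent : LinearlyIndependent basis
      spans       : All (InSpan basis) gs

  -- Greedy selection from the end of the list: a vector is kept exactly when it is outside the span
  -- of those already kept.
  subbasis : ∀ gs → Subbasis gs
  subbasis [] = record
    { size = 0 ; basis = λ () ; ⊆gs = λ () ; independent = λ _ _ () ; spans = [] }
  subbasis (g ∷ gs) with subbasis gs
  ... | record { basis = b ; ⊆gs = b⊆ ; independent = indep ; spans = spans } with inSpan? b g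
  ... | yes g∈ = record { basis = b ; ⊆gs = there ∘ b⊆ ; independent = indep ; spans = g∈ ∷ spans }
  ... | no  g∉ = record
    { basis       = g Vector.∷ b
    ; ⊆gs         = λ { zero → here refl ; (suc i) → there (b⊆ i) }
    ; independent = independent-∷ {g = g} indep g∉
    ; spans       = (e₀ , g≈) ∷ All.map (λ {p} → inSpan-∷ {p = p} g) spans }
    where
    e₀ : Vector Parity _
    e₀ = 1ℙ Vector.∷ λ _ → 0ℙ

    g≈ : g ≈ lincomb e₀ (g Vector.∷ b)
    g≈ s = sym (trans (lincomb-∷ e₀ (g Vector.∷ b) s)
      (trans (cong (coeff g s ℙ.+_) (lincomb-zero b s)) (ℙ.+-identityʳ _)))

  -- The map c ↦ lincomb c b is an injection 𝔽₂ⁿ → 𝔽₂^xs; compare cardinalities.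
  independent⇒≤ : ∀ {n} {b : Vector (Free X) n} → LinearlyIndependent b → n ≤ length xs
  independent⇒≤ {n} {b} b-indep = ℕ.≮⇒≥ λ xs<n →
    ℕ.<⇒≱ (ℕ.^-monoʳ-< 2 (s≤s (s≤s z≤n)) xs<n) (Fin.injective⇒≤ {f = encode} encode-injective)
    where
    coefficients : Fin (2 ^ n) → Vector Parity n
    coefficients k = unbit ∘ finToFun k

    coordinates : Fin (2 ^ n) → Fin (length xs) → Parity
    coordinates k i = coeff (lincomb (coefficients k) b) (lookup xs i)

    encode : Fin (2 ^ n) → Fin (2 ^ length xs)
    encode k = funToFin (bit ∘ coordinates k)

    encode-injective : ∀ {k l} → encode k ≡ encode l → k ≡ l
    encode-injective {k} {l} ek≡el = begin
      k                              ≡⟨ Fin.funToFin-finToFin {n} {2} k ⟨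
      funToFin (finToFun {2} {n} k)  ≡⟨ funToFin-cong same-digit ⟩
      funToFin (finToFun {2} {n} l)  ≡⟨ Fin.funToFin-finToFin {n} {2} l ⟩
      l                              ∎
      where
      same-coordinate : ∀ i → coordinates k i ≡ coordinates l i
      same-coordinate i = begin
        coordinates k i                   ≡⟨ unbit-bit _ ⟨
        unbit (bit (coordinates k i))     ≡⟨ cong unbit (Fin.finToFun-funToFin (bit ∘ coordinates k) i) ⟨
        unbit (finToFun (encode k) i)     ≡⟨ cong (λ e → unbit (finToFun e i)) ek≡el ⟩
        unbit (finToFun (encode l) i)     ≡⟨ cong unbit (Fin.finToFun-funToFin (bit ∘ coordinates l) i) ⟩
        unbit (bit (coordinates l i))     ≡⟨ unbit-bit _ ⟩
        coordinates l i                   ∎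

      same : lincomb (coefficients k) b ≈ lincomb (coefficients l) b
      same s = subst (λ s → lc k s ≡ lc l s) (sym (Any.lookup-index (xs-complete s)))
        (same-coordinate (Any.index (xs-complete s)))
        where
        lc : Fin (2 ^ n) → X → Parity
        lc k = coeff (lincomb (coefficients k) b)

      -- Over 𝔽₂ the sum of the two coefficient vectors is their difference, so independence forces
      -- them to agree.
      difference≈𝟘 : lincomb (λ i → coefficients k i ℙ.+ coefficients l i) b ≈ 𝟘
      difference≈𝟘 s = begin
        coeff (lincomb (λ i → coefficients k i ℙ.+ coefficients l i) b) s
          ≡⟨ lincomb-+ (coefficients k) (coefficients l) b s ⟩
        coeff (lincomb (coefficients k) b) s ℙ.+ L
          ≡⟨ cong (ℙ._+ L) (same s) ⟩
        L ℙ.+ L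
          ≡⟨ ℙ.p+p≡0ℙ L ⟩
        0ℙ ∎
        where
        L : Parity
        L = coeff (lincomb (coefficients l) b) s

      same-digit : ∀ i → finToFun {2} {n} k i ≡ finToFun {2} {n} l i
      same-digit i = begin
        finToFun k i            ≡⟨ bit-unbit _ ⟨
        bit (coefficients k i)  ≡⟨ cong bit (p+q≡0⇒p≡q _ _ (b-indep _ difference≈𝟘 i)) ⟩
        bit (coefficients l i)  ≡⟨ bit-unbit _ ⟩
        finToFun l i            ∎

  pair-lincomb : ∀ (f : X → Parity) {n} (c : Vector Parity n) b →
    (∀ i → ⟪ f ∣ b i ⟫ ≡ 0ℙ) → ⟪ f ∣ lincomb c b ⟫ ≡ 0ℙ
  pair-lincomb f {zero}  c b f⊥b = refl
  pair-lincomb f {suc n} c b f⊥b = trans (pair-⊕ f (c zero · b zero) _)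
    (cong₂ ℙ._+_ (trans (pair-· f (c zero) (b zero))
                        (trans (cong (c zero ℙ.*_) (f⊥b zero)) (ℙ.*-zeroʳ (c zero))))
                 (pair-lincomb f (c ∘ suc) (b ∘ suc) (f⊥b ∘ suc)))

  -- A functional that vanishes on `b` vanishes on its span, while it takes the value 1 at `η s`.
  separated-∷ : ∀ {n} {b : Vector (Free X) n} (f : X → Parity) s →
    LinearlyIndependent b → (∀ i → ⟪ f ∣ b i ⟫ ≡ 0ℙ) → f s ≡ 1ℙ →
    LinearlyIndependent (η s Vector.∷ b)
  separated-∷ {b = b} f s b-indep f⊥b fs≡1 = independent-∷ {g = η s} b-indep λ (c , s≈) →
    contradiction (begin
      1ℙ                   ≡⟨ fs≡1 ⟨
      f s                  ≡⟨ pair-η f s ⟨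
      ⟪ f ∣ η s ⟫          ≡⟨ pair-≈ f {η s} {lincomb c b} s≈ ⟩
      ⟪ f ∣ lincomb c b ⟫  ≡⟨ pair-lincomb f c b f⊥b ⟩
      0ℙ                   ∎) λ ()

-- Coefficient rings

-- The operation `_/_` normalises through a gcd and is stuck on an open numerator; the `mkℚ` form
-- exposes numerator and denominator to computation.
/1-mkℚ : ∀ i → i / 1 ≡ mkℚ i 0 (Coprimality.sym (Coprimality.1-coprimeTo _))
/1-mkℚ i = ℚ.↥p/↧p≡p (mkℚ i 0 (Coprimality.sym (Coprimality.1-coprimeTo _)))

/1-homo-+ : ∀ i j → (i ℤ.+ j) / 1 ≡ i / 1 ℚ.+ j / 1
/1-homo-+ i j = sym (begin
  i / 1 ℚ.+ j / 1
    ≡⟨ cong₂ ℚ._+_ (/1-mkℚ i) (/1-mkℚ j) ⟩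
  (i ℤ.* ℤ.1ℤ ℤ.+ j ℤ.* ℤ.1ℤ) / 1
    ≡⟨ cong₂ (λ a b → (a ℤ.+ b) / 1) (ℤ.*-identityʳ i) (ℤ.*-identityʳ j) ⟩
  (i ℤ.+ j) / 1 ∎)
  where open ≡-Reasoning

/1-injective : ∀ {i j} → i / 1 ≡ j / 1 → i ≡ j
/1-injective {i} {j} i≡j = cong ℚ.↥_ (trans (sym (/1-mkℚ i)) (trans i≡j (/1-mkℚ j)))

ℕ→ℚ : ℕ → ℚ
ℕ→ℚ n = ℤ.+ n / 1

ℕ→ℚ-suc : ∀ n → ℕ→ℚ (suc n) ≡ 1ℚ ℚ.+ ℕ→ℚ n
ℕ→ℚ-suc n = /1-homo-+ (ℤ.+ 1) (ℤ.+ n)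

-- Characteristic 0 enters here: the factors n produced by differentiating y^{ш n} can be divided
-- out.
ℕ→ℚ-suc-cancel : ∀ n q → ℕ→ℚ (suc n) ℚ.* q ≡ 0ℚ → q ≡ 0ℚ
ℕ→ℚ-suc-cancel n q nq≡0 = begin
  q                         ≡⟨ ℚ.*-identityˡ q ⟨
  1ℚ ℚ.* q                  ≡⟨ cong (ℚ._* q) (ℚ.*-inverseˡ r) ⟨
  (ℚ.1/ r) ℚ.* r ℚ.* q      ≡⟨ ℚ.*-assoc (ℚ.1/ r) r q ⟩
  (ℚ.1/ r) ℚ.* (r ℚ.* q)    ≡⟨ cong (λ a → (ℚ.1/ r) ℚ.* (a ℚ.* q)) (/1-mkℚ (ℤ.+ suc n)) ⟨
  (ℚ.1/ r) ℚ.* (ℕ→ℚ (suc n) ℚ.* q) ≡⟨ cong ((ℚ.1/ r) ℚ.*_) nq≡0 ⟩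
  (ℚ.1/ r) ℚ.* 0ℚ           ≡⟨ ℚ.*-zeroʳ (ℚ.1/ r) ⟩
  0ℚ                        ∎
  where
  open ≡-Reasoning
  r : ℚ
  r = mkℚ (ℤ.+ suc n) 0 (Coprimality.sym (Coprimality.1-coprimeTo _))

parity-⊖ : ∀ m n → parity ∣ m ℤ.⊖ n ∣ ≡ parity m ℙ.+ parity n
parity-⊖ m       zero    = sym (ℙ.+-identityʳ _)
parity-⊖ zero    (suc n) = refl
parity-⊖ (suc m) (suc n) = begin
  parity ∣ suc m ℤ.⊖ suc n ∣           ≡⟨ cong (parity ∘ ∣_∣) (ℤ.[1+m]⊖[1+n]≡m⊖n m n) ⟩
  parity ∣ m ℤ.⊖ n ∣                   ≡⟨ parity-⊖ m n ⟩
  parity m ℙ.+ parity n                ≡⟨ ℙ.+-homo-+ m n ⟨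
  -- `parity` recurses in steps of two, so `parity (suc (suc (m ℕ.+ n)))` is already
  -- `parity (m ℕ.+ n)`.
  parity (m ℕ.+ n)                     ≡⟨ cong (parity ∘ suc) (ℕ.+-suc m n) ⟨
  parity (suc m ℕ.+ suc n)             ≡⟨ ℙ.+-homo-+ (suc m) (suc n) ⟩
  parity (suc m) ℙ.+ parity (suc n)    ∎
  where open ≡-Reasoning

parity-+ : ∀ i j → parity ∣ i ℤ.+ j ∣ ≡ parity ∣ i ∣ ℙ.+ parity ∣ j ∣
parity-+ (ℤ.+ m)  (ℤ.+ n)  = ℙ.+-homo-+ m n
parity-+ (ℤ.+ m)  -[1+ n ] = parity-⊖ m (suc n)
parity-+ -[1+ m ] (ℤ.+ n)  = trans (parity-⊖ n (suc m)) (ℙ.+-comm (parity n) _)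
parity-+ -[1+ m ] -[1+ n ] =
  trans (cong (parity ∘ suc) (sym (ℕ.+-suc m n))) (ℙ.+-homo-+ (suc m) (suc n))

-- Words and indices

-- Every term in the recursive expansion of the product has coefficient 1, so a list with
-- repetitions carries all of it, and weights, admissibility and parities become list computations
-- without rational arithmetic.
stuffles : Index → Index → List Index
stuffles []      v       = [ v ]
stuffles (i ∷ u) []      = [ i ∷ u ]
stuffles (i ∷ u) (j ∷ v) =
  (map (i ∷_) (stuffles u (j ∷ v)) ++ map (j ∷_) (stuffles (i ∷ u) v))
  ++ map (i + j ∷_) (stuffles u v)

shuffles : Word → Word → List Word
shuffles []      v       = [ v ]
shuffles (a ∷ u) []      = [ a ∷ u ]
shuffles (a ∷ u) (b ∷ v) = map (a ∷_) (shuffles u (b ∷ v)) ++ map (b ∷_) (shuffles (a ∷ u) v)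

Pos : Index → Set
Pos = All (1 ≤_)

HasWeight : (Index → Set) → ℕ → Index → Set
HasWeight P n t = P t × sum t ≡ n

Adm : ℕ → Index → Set
Adm = HasWeight Admissible

stuffles-pos : ∀ {m n u v} → HasWeight Pos m u → HasWeight Pos n v →
               All (HasWeight Pos (m + n)) (stuffles u v)
stuffles-pos {u = []}         (_ , refl)     v-pos      = v-pos ∷ []
stuffles-pos {u = i ∷ u} {[]} (u-pos , refl) (_ , refl) = (u-pos , sym (ℕ.+-identityʳ _)) ∷ []
stuffles-pos {u = i ∷ u} {j ∷ v} (i>0 ∷ u-pos , refl) (j>0 ∷ v-pos , refl) = All.++⁺
  (All.++⁺
    (cons i>0 (λ e → trans (cong (i +_) e) (sym (ℕ.+-assoc i (sum u) _)))
      (stuffles-pos (u-pos , refl) (j>0 ∷ v-pos , refl)))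
    (cons j>0 (λ e → trans (cong (j +_) e) (x∙yz≈y∙xz j (i + sum u) (sum v)))
      (stuffles-pos (i>0 ∷ u-pos , refl) (v-pos , refl))))
  (cons (ℕ.≤-trans i>0 (ℕ.m≤m+n i j))
    (λ e → trans (cong (i + j +_) e) (interchange i j (sum u) (sum v)))
    (stuffles-pos (u-pos , refl) (v-pos , refl)))
  where
  open import Algebra.Properties.CommutativeSemigroup ℕ.+-commutativeSemigroup
    using (x∙yz≈y∙xz; interchange)
  cons : ∀ {k m n L} → 1 ≤ k → (∀ {l} → l ≡ m → k + l ≡ n) →
         All (HasWeight Pos m) L → All (HasWeight Pos n) (map (k ∷_) L)
  cons k>0 k+m≡n = All.map⁺ ∘ All.map λ (p , e) → k>0 ∷ p , k+m≡n e

≥2⇒pos : ∀ {k} → 2 ≤ k → 1 ≤ k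
≥2⇒pos = ℕ.≤-trans (s≤s z≤n)

adm⇒pos : ∀ {t} → Admissible t → Pos t
adm⇒pos ∅         = []
adm⇒pos (k≥2 ∷ p) = ≥2⇒pos k≥2 ∷ p

data StartsBig : Index → Set where
  big : ∀ {k ks} → 2 ≤ k → StartsBig (k ∷ ks)

big-pos⇒adm : ∀ {t} → StartsBig t → Pos t → Admissible t
big-pos⇒adm (big k≥2) (_ ∷ p) = k≥2 ∷ p

map-big : ∀ {k} → 2 ≤ k → ∀ L → All StartsBig (map (k ∷_) L)
map-big k≥2 L = All.map⁺ (All.universal (λ _ → big k≥2) L)

-- When both indices are nonempty, each term starts with `i`, `j` or `i + j`, all at least 2; the
-- later entries only have to be positive, which is `stuffles-pos`.
stuffles-adm : ∀ {m n u v} → Adm m u → Adm n v → All (Adm (m + n)) (stuffles u v)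
stuffles-adm {u = []} (_ , refl) v-adm = v-adm ∷ []
stuffles-adm {u = i ∷ u} {[]} (u-adm , refl) (_ , refl) = (u-adm , sym (ℕ.+-identityʳ _)) ∷ []
stuffles-adm {u = i ∷ u} {j ∷ v} (u-adm@(i≥2 ∷ _) , eu) (v-adm@(j≥2 ∷ _) , ev) =
  All.zipWith (λ (b , p , e) → big-pos⇒adm b p , e)
    ( All.++⁺
        (All.++⁺ (map-big i≥2 (stuffles u (j ∷ v))) (map-big j≥2 (stuffles (i ∷ u) v)))
        (map-big (ℕ.≤-trans i≥2 (ℕ.m≤m+n i j)) (stuffles u v))
    , stuffles-pos (adm⇒pos u-adm , eu) (adm⇒pos v-adm , ev))

-- The recursion lists `1 ∷ v` first; all other terms start with the first entry of `v`, possibly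
-- increased by 1.
stuffles-1 : ∀ {n v} → Adm n v → All (Adm (suc n)) (drop 1 (stuffles (1 ∷ []) v))
stuffles-1 {v = []}    _ = []
stuffles-1 {v = j ∷ v} (v-adm@(j≥2 ∷ _) , ev) =
  All.zipWith (λ (b , p , e) → big-pos⇒adm b p , e)
    ( All.++⁺ (map-big j≥2 (stuffles (1 ∷ []) v)) (map-big (s≤s (≥2⇒pos j≥2)) (stuffles [] v))
    , All.tail (stuffles-pos (s≤s z≤n ∷ [] , refl) (adm⇒pos v-adm , ev)))

-- H¹ n and H⁰ n are the sets of words of length n in 𝔥¹ and 𝔥⁰.
data H¹ : ℕ → Word → Set where
  []  : H¹ 0 []
  y∷_ : ∀ {n w} → H¹ n w → H¹ (suc n) (y ∷ w)
  x∷_ : ∀ {n w} → H¹ (suc n) w → H¹ (suc (suc n)) (x ∷ w)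

data H⁰ : ℕ → Word → Set where
  []  : H⁰ 0 []
  x∷_ : ∀ {n w} → H¹ (suc n) w → H⁰ (suc (suc n)) (x ∷ w)

H¹-cons : ∀ a {n w} → H¹ (suc n) w → H¹ (suc (suc n)) (a ∷ w)
H¹-cons x h = x∷ h
H¹-cons y h = y∷ h

cons-all : ∀ a {n L} → All (H¹ (suc n)) L → All (H¹ (suc (suc n))) (map (a ∷_) L)
cons-all a = All.map⁺ ∘ All.map (H¹-cons a)

-- The last letter of a shuffle is the last letter of a factor. The length index certifies that a
-- letter is only prepended to a nonempty word, which `x∷_` demands; the two helpers below strip the
-- first letter of one factor.
shuffles-H¹ : ∀ {m n u v} → H¹ m u → H¹ n v → All (H¹ (m + n)) (shuffles u v)

shuffles-H¹-left : ∀ {a m n u v} → H¹ (suc m) (a ∷ u) → H¹ (suc n) v →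
                   All (H¹ (m + suc n)) (shuffles u v)
shuffles-H¹-left (y∷ u) v = shuffles-H¹ u v
shuffles-H¹-left (x∷ u) v = shuffles-H¹ u v

shuffles-H¹-right : ∀ {b m n u v} → H¹ (suc m) u → H¹ (suc n) (b ∷ v) →
                    All (H¹ (suc (m + n))) (shuffles u v)
shuffles-H¹-right u (y∷ v) = shuffles-H¹ u v
shuffles-H¹-right u (x∷ v) = shuffles-H¹ u v

shuffles-H¹ []     v = v ∷ []
shuffles-H¹ {m} {u = a ∷ u} {[]} u′ [] = subst (λ m → H¹ m (a ∷ u)) (sym (ℕ.+-identityʳ m)) u′ ∷ []
shuffles-H¹ {suc m} {suc n} {a ∷ u} {b ∷ v} u′ v′ rewrite ℕ.+-suc m n =
  All.++⁺ (cons-all a (subst (λ k → All (H¹ k) (shuffles u (b ∷ v))) (ℕ.+-suc m n)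
                        (shuffles-H¹-left u′ v′)))
          (cons-all b (shuffles-H¹-right u′ v′))

x-all : ∀ {n L} → All (H¹ (suc n)) L → All (H⁰ (suc (suc n))) (map (x ∷_) L)
x-all = All.map⁺ ∘ All.map x∷_

shuffles-H⁰ : ∀ {m n u v} → H⁰ m u → H⁰ n v → All (H⁰ (m + n)) (shuffles u v)
shuffles-H⁰ []     v = v ∷ []
shuffles-H⁰ {m} {u = x ∷ u} (x∷ u′) [] =
  subst (λ m → H⁰ m (x ∷ u)) (sym (ℕ.+-identityʳ m)) (x∷ u′) ∷ []
shuffles-H⁰ {suc (suc m)} {suc (suc n)} {x ∷ u} {x ∷ v} (x∷ u′) (x∷ v′) =
  All.++⁺ (x-all (shuffles-H¹ u′ (x∷ v′)))
          (subst (λ k → All (H⁰ (suc (suc k))) (map (x ∷_) (shuffles (x ∷ u) v)))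
            (sym (ℕ.+-suc m (suc n)))
            (x-all (shuffles-H¹ (x∷ u′) v′)))

-- Apart from the first shuffle `y ∷ v`, every term takes its first letter from `v`, and that letter
-- is `x`.
shuffles-y : ∀ {n v} → H⁰ n v → All (H⁰ (suc n)) (drop 1 (shuffles (y ∷ []) v))
shuffles-y []     = []
shuffles-y (x∷ v) = x-all (shuffles-H¹ (y∷ []) v)

-- Needed because decompositions carry the power of y as right factor, whereas z₁ is the left factor
-- of its pairs.
shuffles-comm : ∀ u v → shuffles u v ↭ shuffles v u
shuffles-comm []      []      = ↭-refl
shuffles-comm []      (b ∷ v) = ↭-refl
shuffles-comm (a ∷ u) []      = ↭-refl
shuffles-comm (a ∷ u) (b ∷ v) = ↭-trans
  (↭.++⁺ (↭.map⁺ (a ∷_) (shuffles-comm u (b ∷ v))) (↭.map⁺ (b ∷_) (shuffles-comm (a ∷ u) v)))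
  (↭.++-comm (map (a ∷_) (shuffles (b ∷ v) u)) _)

-- The clause for the empty index is a default for words ending in `x`; decoding a word of 𝔥¹ never
-- reaches it.
bump : Index → Index
bump []       = []
bump (k ∷ ks) = suc k ∷ ks

decode : Word → Index
decode []      = []
decode (y ∷ w) = 1 ∷ decode w
decode (x ∷ w) = bump (decode w)

decode-zʷ : ∀ {t} → Pos t → decode (zʷ t) ≡ t
decode-zʷ []                           = refl
decode-zʷ {suc zero ∷ ks}    (s≤s _ ∷ p) = cong (1 ∷_) (decode-zʷ p)
decode-zʷ {suc (suc k) ∷ ks} (s≤s _ ∷ p) = cong bump (decode-zʷ {suc k ∷ ks} (s≤s z≤n ∷ p))

zʷ-H¹ : ∀ {t} → Pos t → H¹ (sum t) (zʷ t)
zʷ-H¹ []                             = []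
zʷ-H¹ {suc zero ∷ ks}    (s≤s _ ∷ p) = y∷ zʷ-H¹ p
zʷ-H¹ {suc (suc k) ∷ ks} (s≤s _ ∷ p) = x∷ zʷ-H¹ {suc k ∷ ks} (s≤s z≤n ∷ p)

zʷ-H⁰ : ∀ {n t} → Adm n t → H⁰ n (zʷ t)
zʷ-H⁰ (∅ , refl)                                      = []
zʷ-H⁰ {t = suc (suc k) ∷ ks} (s≤s (s≤s _) ∷ p , refl) = x∷ zʷ-H¹ {suc k ∷ ks} (s≤s z≤n ∷ p)

-- Separates the empty index from the others, so that the induction knows that `bump` meets a
-- leading entry.
data Decoded (n : ℕ) (w : Word) : Index → Set where
  []  : n ≡ 0 → w ≡ [] → Decoded n w []
  _∷_ : ∀ {k ks} → HasWeight Pos n (suc k ∷ ks) → zʷ (suc k ∷ ks) ≡ w →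
        Decoded n w (suc k ∷ ks)

decode-H¹ : ∀ {n w} → H¹ n w → Decoded n w (decode w)
decode-H¹ [] = [] refl refl
decode-H¹ (y∷_ {w = w} h) with decode w | decode-H¹ h
... | _ | [] refl refl      = (s≤s z≤n ∷ [] , refl) ∷ refl
... | _ | (p , refl) ∷ refl = (s≤s z≤n ∷ p , refl) ∷ refl
decode-H¹ (x∷_ {w = w} h) with decode w | decode-H¹ h
... | _ | (_ ∷ p , refl) ∷ refl = (s≤s z≤n ∷ p , refl) ∷ refl

decode-H⁰ : ∀ {n w} → H⁰ n w → Adm n (decode w) × zʷ (decode w) ≡ w
decode-H⁰ [] = (∅ , refl) , refl
decode-H⁰ (x∷_ {w = w} h) with decode w | decode-H¹ h
... | _ | (_ ∷ p , refl) ∷ refl = (s≤s (s≤s z≤n) ∷ p , refl) , refl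

admissible? : ∀ t → Dec (Admissible t)
admissible? []       = yes ∅
admissible? (k ∷ ks) = map′ (λ (p , q) → p ∷ q) (λ { (p ∷ q) → p , q })
  ((2 ℕ.≤? k) ×-dec All.all? (1 ℕ.≤?_) ks)

H¹⇒snoc : ∀ {n w} → H¹ (suc n) w → ∃ λ u → w ≡ u ++ [ y ]
H¹⇒snoc {w = y ∷ []}    (y∷ [])     = [] , refl
H¹⇒snoc {w = y ∷ a ∷ w} (y∷ h) with h
... | y∷ _ = let (u , e) = H¹⇒snoc h in y ∷ u , cong (y ∷_) e
... | x∷ _ = let (u , e) = H¹⇒snoc h in y ∷ u , cong (y ∷_) e
H¹⇒snoc (x∷ h) = let (u , e) = H¹⇒snoc h in x ∷ u , cong (x ∷_) e

_≟ʷ_ : DecidableEquality Word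
_≟ʷ_ = List.≡-dec _≟ᴸ_

-- Regularization

module _ where
  open Freeℚ
  open Freeℚ.Equality _≟ʷ_ using (_≈_; coeff)
  open Pairing ℚ.+-*-commutativeRing
  open Coeff _≟ʷ_
  open ≡-Reasoning
  open +-*-Solver using (solve; _:+_; _:-_; _:*_; _:=_)

  ∂ : 𝔥 → 𝔥
  ∂ []                  = []
  ∂ ((c , [])    ∷ p) = ∂ p
  ∂ ((c , x ∷ w) ∷ p) = ∂ p
  ∂ ((c , y ∷ w) ∷ p) = (c , w) ∷ ∂ p

  -- The transpose of `∂` on functionals, with `pair-∂` as the adjunction; it maps the coordinate of
  -- `t` to the coordinate of `y ∷ t`.
  ∂ᵀ : (Word → ℚ) → Word → ℚ
  ∂ᵀ f []      = 0ℚ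
  ∂ᵀ f (x ∷ w) = 0ℚ
  ∂ᵀ f (y ∷ w) = f w

  c*0+ : ∀ c q → c ℚ.* 0ℚ ℚ.+ q ≡ q
  c*0+ c q = trans (cong (ℚ._+ q) (ℚ.*-zeroʳ c)) (ℚ.+-identityˡ q)

  pair-∂ : ∀ f p → ⟪ f ∣ ∂ p ⟫ ≡ ⟪ ∂ᵀ f ∣ p ⟫
  pair-∂ f []                = refl
  pair-∂ f ((c , [])    ∷ p) = trans (pair-∂ f p) (sym (c*0+ c _))
  pair-∂ f ((c , x ∷ w) ∷ p) = trans (pair-∂ f p) (sym (c*0+ c _))
  pair-∂ f ((c , y ∷ w) ∷ p) = cong (c ℚ.* f w ℚ.+_) (pair-∂ f p)

  ∂ᵀ-δ : ∀ t w → ∂ᵀ (δ t) w ≡ δ (y ∷ t) w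
  ∂ᵀ-δ t []      = refl
  ∂ᵀ-δ t (x ∷ w) = refl
  ∂ᵀ-δ t (y ∷ w) = refl

  coeff-∂ : ∀ p t → coeff (∂ p) t ≡ coeff p (y ∷ t)
  coeff-∂ p t = begin
    coeff (∂ p) t          ≡⟨ coeff≈pair (∂ p) t ⟩
    ⟪ δ t ∣ ∂ p ⟫          ≡⟨ pair-∂ (δ t) p ⟩
    ⟪ ∂ᵀ (δ t) ∣ p ⟫       ≡⟨ pair-cong (∂ᵀ-δ t) p ⟩
    ⟪ δ (y ∷ t) ∣ p ⟫      ≡⟨ coeff≈pair p (y ∷ t) ⟨
    coeff p (y ∷ t)        ∎

  шʷ-identityʳ : ∀ u → u шʷ [] ≡ η u
  шʷ-identityʳ []      = refl
  шʷ-identityʳ (a ∷ u) = refl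

  coeff-ш : ∀ p q t → coeff (p ш q) t ≡ ⟪ (λ u → ⟪ (λ v → ⟪ δ t ∣ u шʷ v ⟫) ∣ q ⟫) ∣ p ⟫
  coeff-ш p q t = trans (coeff≈pair (p ш q) t) (pair-bilinear (δ t) _шʷ_ p q)

  -- A leading `y` in a shuffle is the leading letter of `u` or of `v`; deleting it leaves a shuffle
  -- with the shortened factor.
  leibnizʷ : ∀ t u v → ⟪ δ (y ∷ t) ∣ u шʷ v ⟫ ≡
    ∂ᵀ (λ u′ → ⟪ δ t ∣ u′ шʷ v ⟫) u ℚ.+ ∂ᵀ (λ v′ → ⟪ δ t ∣ u шʷ v′ ⟫) v
  leibnizʷ t []      []      = refl
  leibnizʷ t []      (x ∷ v) = refl
  leibnizʷ t []      (y ∷ v) = sym (ℚ.+-identityˡ _)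
  leibnizʷ t (x ∷ u) []      = refl
  leibnizʷ t (y ∷ u) []      = sym (trans (ℚ.+-identityʳ _) (cong ⟪ δ t ∣_⟫ (шʷ-identityʳ u)))
  leibnizʷ t (a ∷ u) (b ∷ v) = begin
    ⟪ δ (y ∷ t) ∣ mapBasis (a ∷_) (u шʷ (b ∷ v)) ⊕ mapBasis (b ∷_) ((a ∷ u) шʷ v) ⟫
      ≡⟨ pair-⊕ (δ (y ∷ t)) (mapBasis (a ∷_) (u шʷ (b ∷ v))) _ ⟩
    ⟪ δ (y ∷ t) ∣ mapBasis (a ∷_) (u шʷ (b ∷ v)) ⟫ ℚ.+
    ⟪ δ (y ∷ t) ∣ mapBasis (b ∷_) ((a ∷ u) шʷ v) ⟫
      ≡⟨ cong₂ ℚ._+_ (first a (λ u → u шʷ (b ∷ v)) u) (first b ((a ∷ u) шʷ_) v) ⟩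
    ∂ᵀ (λ u′ → ⟪ δ t ∣ u′ шʷ (b ∷ v) ⟫) (a ∷ u) ℚ.+
    ∂ᵀ (λ v′ → ⟪ δ t ∣ (a ∷ u) шʷ v′ ⟫) (b ∷ v) ∎
    where
    first : ∀ a (g : Word → 𝔥) w →
      ⟪ δ (y ∷ t) ∣ mapBasis (a ∷_) (g w) ⟫ ≡ ∂ᵀ (λ w → ⟪ δ t ∣ g w ⟫) (a ∷ w)
    first x g w = trans (pair-mapBasis (δ (y ∷ t)) (x ∷_) (g w)) (pair-0 (g w))
    first y g w = pair-mapBasis (δ (y ∷ t)) (y ∷_) (g w)

  leibniz : ∀ p q t → coeff (p ш q) (y ∷ t) ≡ coeff (∂ p ш q) t ℚ.+ coeff (p ш ∂ q) t
  leibniz p q t = begin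
    coeff (p ш q) (y ∷ t)
      ≡⟨ coeff-ш p q (y ∷ t) ⟩
    ⟪ (λ u → ⟪ (λ v → ⟪ δ (y ∷ t) ∣ u шʷ v ⟫) ∣ q ⟫) ∣ p ⟫
      ≡⟨ pair-cong inner p ⟩
    ⟪ (λ u → ∂ᵀ (λ u′ → ⟪ F u′ ∣ q ⟫) u ℚ.+ ⟪ F u ∣ ∂ q ⟫) ∣ p ⟫
      ≡⟨ pair-+ (∂ᵀ (λ u′ → ⟪ F u′ ∣ q ⟫)) (λ u → ⟪ F u ∣ ∂ q ⟫) p ⟩
    ⟪ ∂ᵀ (λ u′ → ⟪ F u′ ∣ q ⟫) ∣ p ⟫ ℚ.+ ⟪ (λ u → ⟪ F u ∣ ∂ q ⟫) ∣ p ⟫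
      ≡⟨ cong₂ ℚ._+_ (sym (trans (coeff-ш (∂ p) q t) (pair-∂ _ p))) (sym (coeff-ш p (∂ q) t)) ⟩
    coeff (∂ p ш q) t ℚ.+ coeff (p ш ∂ q) t ∎
    where
    F : Word → Word → ℚ
    F u v = ⟪ δ t ∣ u шʷ v ⟫

    left : ∀ u → ⟪ (λ v → ∂ᵀ (λ u′ → F u′ v) u) ∣ q ⟫ ≡ ∂ᵀ (λ u′ → ⟪ F u′ ∣ q ⟫) u
    left []      = pair-0 q
    left (x ∷ u) = pair-0 q
    left (y ∷ u) = refl

    inner : ∀ u → ⟪ (λ v → ⟪ δ (y ∷ t) ∣ u шʷ v ⟫) ∣ q ⟫ ≡
                  ∂ᵀ (λ u′ → ⟪ F u′ ∣ q ⟫) u ℚ.+ ⟪ F u ∣ ∂ q ⟫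
    inner u = begin
      ⟪ (λ v → ⟪ δ (y ∷ t) ∣ u шʷ v ⟫) ∣ q ⟫
        ≡⟨ pair-cong (leibnizʷ t u) q ⟩
      ⟪ (λ v → ∂ᵀ (λ u′ → F u′ v) u ℚ.+ ∂ᵀ (F u) v) ∣ q ⟫
        ≡⟨ pair-+ (λ v → ∂ᵀ (λ u′ → F u′ v) u) (∂ᵀ (F u)) q ⟩
      ⟪ (λ v → ∂ᵀ (λ u′ → F u′ v) u) ∣ q ⟫ ℚ.+ ⟪ ∂ᵀ (F u) ∣ q ⟫
        ≡⟨ cong₂ ℚ._+_ (left u) (sym (pair-∂ (F u) q)) ⟩
      ∂ᵀ (λ u′ → ⟪ F u′ ∣ q ⟫) u ℚ.+ ⟪ F u ∣ ∂ q ⟫ ∎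

  ш-cong : ∀ {p p′ q q′} → p ≈ p′ → q ≈ q′ → p ш q ≈ p′ ш q′
  ш-cong {p} {p′} {q} {q′} p≈p′ q≈q′ t = begin
    coeff (p ш q) t            ≡⟨ coeff-ш p q t ⟩
    ⟪ (λ u → ⟪ F u ∣ q ⟫) ∣ p ⟫  ≡⟨ pair-cong (λ u → pair-≈ (F u) {q} {q′} q≈q′) p ⟩
    ⟪ (λ u → ⟪ F u ∣ q′ ⟫) ∣ p ⟫ ≡⟨ pair-≈ _ {p} {p′} p≈p′ ⟩
    ⟪ (λ u → ⟪ F u ∣ q′ ⟫) ∣ p′ ⟫ ≡⟨ coeff-ш p′ q′ t ⟨
    coeff (p′ ш q′) t          ∎
    where
    F : Word → Word → ℚ
    F u v = ⟪ δ t ∣ u шʷ v ⟫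

  ш-congˡ : ∀ p {q q′} → q ≈ q′ → p ш q ≈ p ш q′
  ш-congˡ p {q} {q′} = ш-cong {p} {p} {q} {q′} (λ _ → refl)

  ш-congʳ : ∀ {p p′} q → p ≈ p′ → p ш q ≈ p′ ш q
  ш-congʳ {p} {p′} q p≈p′ = ш-cong {p} {p′} {q} {q} p≈p′ (λ _ → refl)

  ш-scaleˡ : ∀ c p q t → coeff ((c · p) ш q) t ≡ c ℚ.* coeff (p ш q) t
  ш-scaleˡ c p q t = trans (coeff-ш (c · p) q t)
    (trans (pair-· _ c p) (cong (c ℚ.*_) (sym (coeff-ш p q t))))

  ш-scaleʳ : ∀ c p q t → coeff (p ш (c · q)) t ≡ c ℚ.* coeff (p ш q) t
  ш-scaleʳ c p q t = begin
    coeff (p ш (c · q)) t ≡⟨ coeff-ш p (c · q) t ⟩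
    _ ≡⟨ pair-cong (λ u → pair-· (λ v → ⟪ δ t ∣ u шʷ v ⟫) c q) p ⟩
    _ ≡⟨ pair-* c (λ u → ⟪ (λ v → ⟪ δ t ∣ u шʷ v ⟫) ∣ q ⟫) p ⟩
    _ ≡⟨ cong (c ℚ.*_) (coeff-ш p q t) ⟨
    c ℚ.* coeff (p ш q) t ∎

  ш-distribʳ-⊖ : ∀ p p′ q t → coeff ((p ⊖ p′) ш q) t ≡ coeff (p ш q) t ℚ.- coeff (p′ ш q) t
  ш-distribʳ-⊖ p p′ q t = begin
    coeff ((p ⊖ p′) ш q) t ≡⟨ coeff-ш (p ⊖ p′) q t ⟩
    _                      ≡⟨ pair-⊖ _ p p′ ⟩
    _                      ≡⟨ cong₂ ℚ._-_ (coeff-ш p q t) (coeff-ш p′ q t) ⟨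
    coeff (p ш q) t ℚ.- coeff (p′ ш q) t ∎

  ш-identityˡ : ∀ p → η [] ш p ≈ p
  ш-identityˡ p t = begin
    coeff (η [] ш p) t ≡⟨ coeff-ш (η []) p t ⟩
    _                  ≡⟨ pair-η (λ u → ⟪ (λ v → ⟪ δ t ∣ u шʷ v ⟫) ∣ p ⟫) [] ⟩
    ⟪ (λ v → ⟪ δ t ∣ η v ⟫) ∣ p ⟫ ≡⟨ pair-cong (λ v → pair-η (δ t) v) p ⟩
    ⟪ δ t ∣ p ⟫        ≡⟨ coeff≈pair p t ⟨
    coeff p t          ∎

  ш-identityʳ : ∀ p → p ш η [] ≈ p
  ш-identityʳ p t = begin
    coeff (p ш η []) t ≡⟨ coeff-ш p (η []) t ⟩
    _                  ≡⟨ pair-cong (λ u → trans (pair-η (λ v → ⟪ δ t ∣ u шʷ v ⟫) [])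
                            (trans (cong ⟪ δ t ∣_⟫ (шʷ-identityʳ u)) (pair-η (δ t) u))) p ⟩
    ⟪ δ t ∣ p ⟫        ≡⟨ coeff≈pair p t ⟨
    coeff p t          ∎

  -- The Leibniz rule by induction, since `∂` sends y to the unit. At `n` = 0 the factor 0 makes the
  -- truncated exponent harmless.
  ∂-yш : ∀ n → ∂ (yш^ n) ≈ ℕ→ℚ n · yш^ (n ∸ 1)
  ∂-yш zero    t = sym (trans (coeff-· (ℕ→ℚ 0) (η []) t) (ℚ.*-zeroˡ (coeff (η []) t)))
  ∂-yш (suc n) t = begin
    coeff (∂ (η [ y ] ш yш^ n)) t               ≡⟨ coeff-∂ (η [ y ] ш yш^ n) t ⟩
    coeff (η [ y ] ш yш^ n) (y ∷ t)             ≡⟨ leibniz (η [ y ]) (yш^ n) t ⟩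
    coeff (η [] ш yш^ n) t ℚ.+ coeff (η [ y ] ш ∂ (yш^ n)) t
      ≡⟨ cong₂ ℚ._+_ (ш-identityˡ (yш^ n) t)
           (trans (ш-congˡ (η [ y ]) {∂ (yш^ n)} {ℕ→ℚ n · yш^ (n ∸ 1)} (∂-yш n) t) (rest n)) ⟩
    coeff (yш^ n) t ℚ.+ ℕ→ℚ n ℚ.* coeff (yш^ n) t
      ≡⟨ cong (ℚ._+ ℕ→ℚ n ℚ.* coeff (yш^ n) t) (ℚ.*-identityˡ (coeff (yш^ n) t)) ⟨
    1ℚ ℚ.* coeff (yш^ n) t ℚ.+ ℕ→ℚ n ℚ.* coeff (yш^ n) t
      ≡⟨ ℚ.*-distribʳ-+ (coeff (yш^ n) t) 1ℚ (ℕ→ℚ n) ⟨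
    (1ℚ ℚ.+ ℕ→ℚ n) ℚ.* coeff (yш^ n) t          ≡⟨ cong (ℚ._* coeff (yш^ n) t) (ℕ→ℚ-suc n) ⟨
    ℕ→ℚ (suc n) ℚ.* coeff (yш^ n) t             ≡⟨ coeff-· (ℕ→ℚ (suc n)) (yш^ n) t ⟨
    coeff (ℕ→ℚ (suc n) · yш^ n) t               ∎
    where
    rest : ∀ n → coeff (η [ y ] ш (ℕ→ℚ n · yш^ (n ∸ 1))) t ≡ ℕ→ℚ n ℚ.* coeff (yш^ n) t
    -- Here y ш y^{ш (n ∸ 1)} is y and not the unit, but both sides carry the factor 0.
    rest zero    = trans (ш-scaleʳ (ℕ→ℚ 0) (η [ y ]) (η []) t) 
      (trans (ℚ.*-zeroˡ (coeff (η [ y ] ш η []) t)) (sym (ℚ.*-zeroˡ (coeff (η []) t))))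
    rest (suc n) = ш-scaleʳ (ℕ→ℚ (suc n)) (η [ y ]) (yш^ n) t

  -- Uniqueness of decompositions in powers of y

  Ker∂ : 𝔥 → Set
  Ker∂ p = ∀ t → coeff p (y ∷ t) ≡ 0ℚ

  -- The power rule, with `p` as a constant for the derivation.
  ker-ш-yш : ∀ p → Ker∂ p → ∀ n t →
    coeff (p ш yш^ (suc n)) (y ∷ t) ≡ coeff ((ℕ→ℚ (suc n) · p) ш yш^ n) t
  ker-ш-yш p ∂p≈0 n t = begin
    coeff (p ш yш^ (suc n)) (y ∷ t)
      ≡⟨ leibniz p (yш^ (suc n)) t ⟩
    coeff (∂ p ш yш^ (suc n)) t ℚ.+ coeff (p ш ∂ (yш^ (suc n))) t
      ≡⟨ cong₂ ℚ._+_
           (ш-congʳ {∂ p} {𝟘} (yш^ (suc n)) (λ s → trans (coeff-∂ p s) (∂p≈0 s)) t)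
           (ш-congˡ p {∂ (yш^ (suc n))} {ℕ→ℚ (suc n) · yш^ n} (∂-yш (suc n)) t) ⟩
    0ℚ ℚ.+ coeff (p ш (ℕ→ℚ (suc n) · yш^ n)) t
      ≡⟨ ℚ.+-identityˡ _ ⟩
    coeff (p ш (ℕ→ℚ (suc n) · yш^ n)) t
      ≡⟨ ш-scaleʳ (ℕ→ℚ (suc n)) p (yш^ n) t ⟩
    ℕ→ℚ (suc n) ℚ.* coeff (p ш yш^ n) t
      ≡⟨ ш-scaleˡ (ℕ→ℚ (suc n)) p (yш^ n) t ⟨
    coeff ((ℕ→ℚ (suc n) · p) ш yш^ n) t ∎

  -- Two words `s` and `t` occur because a derivative at `t` is compared with the original at
  -- `y ∷ t`.
  ∑-coeff : ∀ {n s t} {u v : Vector 𝔥 n} → (∀ i → coeff (u i) s ≡ coeff (v i) t) →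
    coeff (∑ u) s ≡ coeff (∑ v) t
  ∑-coeff {zero}                u≈v = refl
  ∑-coeff {suc n} {s} {t} {u} {v} u≈v =
    trans (coeff-⊕ (u zero) (∑ (u ∘ suc)) s)
    (trans (cong₂ ℚ._+_ (u≈v zero) (∑-coeff {n} {s} {t} {u ∘ suc} {v ∘ suc} (u≈v ∘ suc)))
           (sym (coeff-⊕ (v zero) (∑ (v ∘ suc)) t)))

  ∑-𝟘 : ∀ {n} {u : Vector 𝔥 n} → (∀ i → u i ≈ 𝟘) → ∑ u ≈ 𝟘
  ∑-𝟘 {zero}      u≈𝟘 t = refl
  ∑-𝟘 {suc n} {u} u≈𝟘 t = trans (coeff-⊕ (u zero) (∑ (u ∘ suc)) t)
    (trans (cong₂ ℚ._+_ (u≈𝟘 zero t) (∑-𝟘 {n} {u ∘ suc} (u≈𝟘 ∘ suc) t)) (ℚ.+-identityˡ _))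

  yPoly : ∀ {n} → Vector 𝔥 n → 𝔥
  yPoly w = ∑ λ i → w i ш yш^ toℕ i

  -- As for ordinary polynomials in characteristic 0: the derivative has one coefficient fewer and
  -- vanishes too, so by induction all higher coefficients vanish after division by i + 1; the
  -- constant term is then what remains.
  yPoly-injective : ∀ {n} (w : Vector 𝔥 n) → (∀ i → Ker∂ (w i)) → yPoly w ≈ 𝟘 → ∀ i → w i ≈ 𝟘
  yPoly-injective {suc n} w ker poly≈𝟘 = λ { zero → head≈𝟘 ; (suc i) → tail≈𝟘 i }
    where
    higher : 𝔥
    higher = ∑ λ i → w (suc i) ш yш^ suc (toℕ i)

    ∂w : Vector 𝔥 n
    ∂w i = ℕ→ℚ (suc (toℕ i)) · w (suc i)

    coeff-∂w : ∀ i t → coeff (∂w i) t ≡ ℕ→ℚ (suc (toℕ i)) ℚ.* coeff (w (suc i)) t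
    coeff-∂w i = coeff-· (ℕ→ℚ (suc (toℕ i))) (w (suc i))

    ∂w-ker : ∀ i → Ker∂ (∂w i)
    ∂w-ker i t = trans (coeff-∂w i (y ∷ t))
      (trans (cong (ℕ→ℚ (suc (toℕ i)) ℚ.*_) (ker (suc i) t)) (ℚ.*-zeroʳ (ℕ→ℚ (suc (toℕ i)))))

    ∂poly≈𝟘 : yPoly ∂w ≈ 𝟘
    ∂poly≈𝟘 t = begin
      coeff (yPoly ∂w) t
        ≡⟨ ∑-coeff {n} {t} {y ∷ t} {λ i → ∂w i ш yш^ toℕ i} {λ i → w (suc i) ш yш^ suc (toℕ i)}
             (λ i → sym (ker-ш-yш (w (suc i)) (ker (suc i)) (toℕ i) t)) ⟩
      coeff higher (y ∷ t)
        ≡⟨ ℚ.+-identityˡ _ ⟨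
      0ℚ ℚ.+ coeff higher (y ∷ t)
        ≡⟨ cong (ℚ._+ coeff higher (y ∷ t)) (trans (ш-identityʳ (w zero) (y ∷ t)) (ker zero t)) ⟨
      coeff (w zero ш η []) (y ∷ t) ℚ.+ coeff higher (y ∷ t)
        ≡⟨ coeff-⊕ (w zero ш η []) higher (y ∷ t) ⟨
      coeff (yPoly w) (y ∷ t)
        ≡⟨ poly≈𝟘 (y ∷ t) ⟩
      0ℚ ∎

    tail≈𝟘 : ∀ i → w (suc i) ≈ 𝟘
    tail≈𝟘 i t = ℕ→ℚ-suc-cancel (toℕ i) _
      (trans (sym (coeff-∂w i t)) (yPoly-injective ∂w ∂w-ker ∂poly≈𝟘 i t))

    higher≈𝟘 : higher ≈ 𝟘
    higher≈𝟘 = ∑-𝟘 {u = λ i → w (suc i) ш yш^ suc (toℕ i)}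
      λ i → ш-congʳ {w (suc i)} {𝟘} (yш^ suc (toℕ i)) (tail≈𝟘 i)

    head≈𝟘 : w zero ≈ 𝟘
    head≈𝟘 t = begin
      coeff (w zero) t                            ≡⟨ ш-identityʳ (w zero) t ⟨
      coeff (w zero ш η []) t                     ≡⟨ ℚ.+-identityʳ _ ⟨
      coeff (w zero ш η []) t ℚ.+ 0ℚ              ≡⟨ cong (coeff (w zero ш η []) t ℚ.+_) (higher≈𝟘 t) ⟨
      coeff (w zero ш η []) t ℚ.+ coeff higher t  ≡⟨ coeff-⊕ (w zero ш η []) higher t ⟨
      coeff (yPoly w) t                           ≡⟨ poly≈𝟘 t ⟩
      0ℚ                                          ∎

  δ-y∷-x∷ : ∀ (f : Word → Word) u t → ⟪ δ (y ∷ t) ∣ mapBasis (λ v → x ∷ f v) u ⟫ ≡ 0ℚ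
  δ-y∷-x∷ f u t = trans (pair-mapBasis (δ (y ∷ t)) (λ v → x ∷ f v) u) (pair-0 u)

  x⟦_⟧y : 𝔥 → 𝔥
  x⟦_⟧y = mapBasis (λ v → x ∷ v ++ [ y ])

  coeff-𝔥⁰ : ∀ c u t → coeff (c · η [] ⊕ x⟦ u ⟧y) t ≡ c ℚ.* coeff (η []) t ℚ.+ coeff x⟦ u ⟧y t
  coeff-𝔥⁰ c u t = trans (coeff-⊕ (c · η []) x⟦ u ⟧y t)
    (cong (ℚ._+ coeff x⟦ u ⟧y t) (coeff-· c (η []) t))

  𝔥⁰⇒ker : ∀ {w} → 𝔥⁰ w → Ker∂ w
  𝔥⁰⇒ker {w} (c , u , w≈) t = begin
    coeff w (y ∷ t)                       ≡⟨ w≈ (y ∷ t) ⟩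
    coeff (c · η [] ⊕ x⟦ u ⟧y) (y ∷ t)    ≡⟨ coeff-𝔥⁰ c u (y ∷ t) ⟩
    c ℚ.* 0ℚ ℚ.+ coeff x⟦ u ⟧y (y ∷ t)    ≡⟨ c*0+ c _ ⟩
    coeff x⟦ u ⟧y (y ∷ t)                 ≡⟨ coeff≈pair x⟦ u ⟧y (y ∷ t) ⟩
    ⟪ δ (y ∷ t) ∣ x⟦ u ⟧y ⟫               ≡⟨ δ-y∷-x∷ (_++ [ y ]) u t ⟩
    0ℚ                                    ∎

  𝔥⁰-𝟘 : 𝔥⁰ 𝟘
  𝔥⁰-𝟘 = 0ℚ , 𝟘 , λ t → sym (trans (coeff-𝔥⁰ 0ℚ 𝟘 t)
    (trans (ℚ.+-identityʳ _) (ℚ.*-zeroˡ (coeff (η []) t))))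

  𝔥⁰-⊕ : ∀ {p q} → 𝔥⁰ p → 𝔥⁰ q → 𝔥⁰ (p ⊕ q)
  𝔥⁰-⊕ {p} {q} (c , u , p≈) (c′ , u′ , q≈) = c ℚ.+ c′ , u ⊕ u′ , λ t → begin
    coeff (p ⊕ q) t
      ≡⟨ coeff-⊕ p q t ⟩
    coeff p t ℚ.+ coeff q t
      ≡⟨ cong₂ ℚ._+_ (trans (p≈ t) (coeff-𝔥⁰ c u t)) (trans (q≈ t) (coeff-𝔥⁰ c′ u′ t)) ⟩
    (c ℚ.* e t ℚ.+ coeff x⟦ u ⟧y t) ℚ.+ (c′ ℚ.* e t ℚ.+ coeff x⟦ u′ ⟧y t)
      ≡⟨ solve 5 (λ c c′ e a b → (c :* e :+ a) :+ (c′ :* e :+ b) := (c :+ c′) :* e :+ (a :+ b))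
           refl c c′ (e t) (coeff x⟦ u ⟧y t) (coeff x⟦ u′ ⟧y t) ⟩
    (c ℚ.+ c′) ℚ.* e t ℚ.+ (coeff x⟦ u ⟧y t ℚ.+ coeff x⟦ u′ ⟧y t)
      ≡⟨ cong ((c ℚ.+ c′) ℚ.* e t ℚ.+_) (coeff-⊕ x⟦ u ⟧y x⟦ u′ ⟧y t) ⟨
    (c ℚ.+ c′) ℚ.* e t ℚ.+ coeff (x⟦ u ⟧y ⊕ x⟦ u′ ⟧y) t
      ≡⟨ cong (λ p → (c ℚ.+ c′) ℚ.* e t ℚ.+ coeff p t) (List.map-++ _ u u′) ⟨
    (c ℚ.+ c′) ℚ.* e t ℚ.+ coeff x⟦ u ⊕ u′ ⟧y t
      ≡⟨ coeff-𝔥⁰ (c ℚ.+ c′) (u ⊕ u′) t ⟨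
    coeff ((c ℚ.+ c′) · η [] ⊕ x⟦ u ⊕ u′ ⟧y) t ∎
    where
    e : Word → ℚ
    e = coeff (η [])

  𝔥⁰-· : ∀ a {p} → 𝔥⁰ p → 𝔥⁰ (a · p)
  𝔥⁰-· a {p} (c , u , p≈) = a ℚ.* c , a · u , λ t → begin
    coeff (a · p) t
      ≡⟨ trans (coeff-· a p t) (cong (a ℚ.*_) (trans (p≈ t) (coeff-𝔥⁰ c u t))) ⟩
    a ℚ.* (c ℚ.* e t ℚ.+ coeff x⟦ u ⟧y t)
      ≡⟨ solve 4 (λ a c e b → a :* (c :* e :+ b) := a :* c :* e :+ a :* b)
           refl a c (e t) (coeff x⟦ u ⟧y t) ⟩
    a ℚ.* c ℚ.* e t ℚ.+ a ℚ.* coeff x⟦ u ⟧y t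
      ≡⟨ cong (a ℚ.* c ℚ.* e t ℚ.+_) (coeff-· a x⟦ u ⟧y t) ⟨
    a ℚ.* c ℚ.* e t ℚ.+ coeff (a · x⟦ u ⟧y) t
      ≡⟨ cong (λ q → a ℚ.* c ℚ.* e t ℚ.+ coeff q t) (·-x∷y u) ⟩
    a ℚ.* c ℚ.* e t ℚ.+ coeff x⟦ a · u ⟧y t
      ≡⟨ coeff-𝔥⁰ (a ℚ.* c) (a · u) t ⟨
    coeff ((a ℚ.* c) · η [] ⊕ x⟦ a · u ⟧y) t ∎
    where
    e : Word → ℚ
    e = coeff (η [])

    ·-x∷y : ∀ u → a · x⟦ u ⟧y ≡ x⟦ a · u ⟧y
    ·-x∷y []      = refl
    ·-x∷y (_ ∷ u) = cong (_ ∷_) (·-x∷y u)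

  𝔥⁰-⊖ : ∀ {p q} → 𝔥⁰ p → 𝔥⁰ q → 𝔥⁰ (p ⊖ q)
  𝔥⁰-⊖ {p} {q} hp hq = 𝔥⁰-⊕ {p} {(ℚ.- 1ℚ) · q} hp (𝔥⁰-· (ℚ.- 1ℚ) {q} hq)

  𝔥⁰-η : ∀ {n w} → H⁰ n w → 𝔥⁰ (η w)
  𝔥⁰-η []     = 1ℚ , [] , λ t → refl
  𝔥⁰-η (x∷ h) with H¹⇒snoc h
  ... | u , refl = 0ℚ , η u , λ t → sym (begin
    coeff (0ℚ · η [] ⊕ x⟦ η u ⟧y) t                ≡⟨ coeff-𝔥⁰ 0ℚ (η u) t ⟩
    0ℚ ℚ.* coeff (η []) t ℚ.+ coeff x⟦ η u ⟧y t    ≡⟨ cong (ℚ._+ coeff x⟦ η u ⟧y t) (ℚ.*-zeroˡ (coeff (η []) t)) ⟩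
    0ℚ ℚ.+ coeff x⟦ η u ⟧y t                       ≡⟨ ℚ.+-identityˡ _ ⟩
    coeff x⟦ η u ⟧y t                              ∎)

  -- Degree at most 1 in y suffices for the products considered: only the left factor z₁ brings in a
  -- leading y.
  record Regularizes (w a : 𝔥) : Set where
    field
      rest    : 𝔥
      reg-𝔥⁰  : 𝔥⁰ a
      rest-𝔥⁰ : 𝔥⁰ rest
      decomp  : w ≈ a ⊕ rest ш yш^ 1

  isReg : ∀ {w a} → Regularizes w a → IsReg w a
  isReg {w} {a} r = 1 , ws , (λ { zero → reg-𝔥⁰ ; (suc zero) → rest-𝔥⁰ }) , w≈ , λ _ → refl
    where
    open Regularizes r
    ws : Vector 𝔥 2
    ws = a Vector.∷ rest Vector.∷ Vector.[]
    w≈ : w ≈ ∑ (λ i → ws i ш yш^ toℕ i)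
    w≈ t = begin
      coeff w t                                         ≡⟨ decomp t ⟩
      coeff (a ⊕ rest ш yш^ 1) t                        ≡⟨ coeff-⊕ a (rest ш yш^ 1) t ⟩
      coeff a t ℚ.+ coeff (rest ш yш^ 1) t
        ≡⟨ cong₂ ℚ._+_ (ш-identityʳ a t) (cong (λ p → coeff p t) (List.++-identityʳ (rest ш yш^ 1))) ⟨
      coeff (a ш η []) t ℚ.+ coeff (rest ш yш^ 1 ⊕ 𝟘) t ≡⟨ coeff-⊕ (a ш η []) (rest ш yш^ 1 ⊕ 𝟘) t ⟨
      coeff (∑ (λ i → ws i ш yш^ toℕ i)) t              ∎

  isReg-unique : ∀ {w a v} → Regularizes w a → IsReg w v → v ≈ a
  isReg-unique {w} {a} {v} r (zero , ws , ws-𝔥⁰ , w≈ , v≈) =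
    -- Padding with a zero coefficient reaches degree 1, the degree of `Regularizes`. As `𝟘 ш yш^ 1`
    -- computes to the empty sum, `w≈` is reused unchanged.
    isReg-unique {v = v} r
      ( 1 , ws zero Vector.∷ 𝟘 Vector.∷ Vector.[]
      , (λ { zero → ws-𝔥⁰ zero ; (suc zero) → 𝔥⁰-𝟘 }) , w≈ , v≈ )
  isReg-unique {w} {a} {v} r (suc m , ws , ws-𝔥⁰ , w≈ , v≈) t = begin
    coeff v t           ≡⟨ v≈ t ⟩
    coeff (ws zero) t   ≡⟨ x∙y⁻¹≈ε⇒x≈y _ _ (trans (sym (coeff-⊖ (ws zero) a t))
                                              (yPoly-injective diff diff-ker diff≈𝟘 zero t)) ⟩
    coeff a t           ∎
    where
    open Regularizes r
    open import Algebra.Properties.AbelianGroup ℚ.+-0-abelianGroup using (x∙y⁻¹≈ε⇒x≈y)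
    diff : Vector 𝔥 (suc (suc m))
    diff zero          = ws zero ⊖ a
    diff (suc zero)    = ws (suc zero) ⊖ rest
    diff (suc (suc i)) = ws (suc (suc i))

    diff-ker : ∀ i → Ker∂ (diff i)
    diff-ker zero          = 𝔥⁰⇒ker {diff zero} (𝔥⁰-⊖ {ws zero} {a} (ws-𝔥⁰ zero) reg-𝔥⁰)
    diff-ker (suc zero)    =
      𝔥⁰⇒ker {diff (suc zero)} (𝔥⁰-⊖ {ws (suc zero)} {rest} (ws-𝔥⁰ (suc zero)) rest-𝔥⁰)
    diff-ker (suc (suc i)) = 𝔥⁰⇒ker {ws (suc (suc i))} (ws-𝔥⁰ (suc (suc i)))

    tail : 𝔥
    tail = ∑ (λ i → ws (suc (suc i)) ш yш^ suc (suc (toℕ i)))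

    A B A′ B′ T : Word → ℚ
    A  t = coeff (ws zero ш η []) t
    B  t = coeff (ws (suc zero) ш yш^ 1) t
    A′ t = coeff a t
    B′ t = coeff (rest ш yш^ 1) t
    T  t = coeff tail t

    same : ∀ t → A t ℚ.+ (B t ℚ.+ T t) ≡ A′ t ℚ.+ B′ t
    same t = begin
      A t ℚ.+ (B t ℚ.+ T t)  ≡⟨ cong (A t ℚ.+_) (coeff-⊕ (ws (suc zero) ш yш^ 1) tail t) ⟨
      A t ℚ.+ _              ≡⟨ coeff-⊕ (ws zero ш η []) (ws (suc zero) ш yш^ 1 ⊕ tail) t ⟨
      _                      ≡⟨ w≈ t ⟨
      coeff w t              ≡⟨ decomp t ⟩
      _                      ≡⟨ coeff-⊕ a (rest ш yш^ 1) t ⟩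
      A′ t ℚ.+ B′ t          ∎

    diff≈𝟘 : yPoly diff ≈ 𝟘
    diff≈𝟘 t = begin
      coeff (yPoly diff) t
        ≡⟨ coeff-⊕ ((ws zero ⊖ a) ш η []) _ t ⟩
      coeff ((ws zero ⊖ a) ш η []) t ℚ.+ coeff ((ws (suc zero) ⊖ rest) ш yш^ 1 ⊕ tail) t
        ≡⟨ cong₂ ℚ._+_ (ш-distribʳ-⊖ (ws zero) a (η []) t)
                       (trans (coeff-⊕ ((ws (suc zero) ⊖ rest) ш yш^ 1) tail t)
                              (cong (ℚ._+ T t) (ш-distribʳ-⊖ (ws (suc zero)) rest (yш^ 1) t))) ⟩
      (A t ℚ.- coeff (a ш η []) t) ℚ.+ ((B t ℚ.- B′ t) ℚ.+ T t)
        ≡⟨ cong (λ c → (A t ℚ.- c) ℚ.+ ((B t ℚ.- B′ t) ℚ.+ T t)) (ш-identityʳ a t) ⟩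
      (A t ℚ.- A′ t) ℚ.+ ((B t ℚ.- B′ t) ℚ.+ T t)
        ≡⟨ solve 5 (λ A B A′ B′ T → (A :- A′) :+ ((B :- B′) :+ T) := (A :+ (B :+ T)) :- (A′ :+ B′))
             refl (A t) (B t) (A′ t) (B′ t) (T t) ⟩
      (A t ℚ.+ (B t ℚ.+ T t)) ℚ.- (A′ t ℚ.+ B′ t)
        ≡⟨ cong (ℚ._- (A′ t ℚ.+ B′ t)) (same t) ⟩
      (A′ t ℚ.+ B′ t) ℚ.- (A′ t ℚ.+ B′ t)
        ≡⟨ ℚ.+-inverseʳ (A′ t ℚ.+ B′ t) ⟩
      0ℚ ∎

  -- Products of basis elements as lists, and their regularization

  ∗ʷ-formal : ∀ u v → u ∗ʷ v ≡ formal (stuffles u v)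
  ∗ʷ-formal []      v       = refl
  ∗ʷ-formal (i ∷ u) []      = refl
  ∗ʷ-formal (i ∷ u) (j ∷ v) = sym (begin
    formal ((A ++ B) ++ C)
      ≡⟨ trans (formal-++ (A ++ B) C) (cong (_⊕ formal C) (formal-++ A B)) ⟩
    formal A ⊕ formal B ⊕ formal C
      ≡⟨ cong₂ _⊕_ (cong₂ _⊕_ (step (i ∷_) u (j ∷ v)) (step (j ∷_) (i ∷ u) v)) (step (i + j ∷_) u v) ⟩
    (i ∷ u) ∗ʷ (j ∷ v) ∎)
    where
    A B C : List Index
    A = map (i ∷_) (stuffles u (j ∷ v))
    B = map (j ∷_) (stuffles (i ∷ u) v)
    C = map (i + j ∷_) (stuffles u v)
    step : ∀ f u v → formal (map f (stuffles u v)) ≡ mapBasis f (u ∗ʷ v)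
    step f u v = trans (sym (formal-map f (stuffles u v))) (cong (mapBasis f) (sym (∗ʷ-formal u v)))

  шʷ-formal : ∀ u v → u шʷ v ≡ formal (shuffles u v)
  шʷ-formal []      v       = refl
  шʷ-formal (a ∷ u) []      = refl
  шʷ-formal (a ∷ u) (b ∷ v) = sym (trans (formal-++ (map (a ∷_) (shuffles u (b ∷ v))) _)
    (cong₂ _⊕_ (step (a ∷_) u (b ∷ v)) (step (b ∷_) (a ∷ u) v)))
    where
    step : ∀ f u v → formal (map f (shuffles u v)) ≡ mapBasis f (u шʷ v)
    step f u v = trans (sym (formal-map f (shuffles u v))) (cong (mapBasis f) (sym (шʷ-formal u v)))

  η-∗-η : ∀ u v → ι (η u ∗ η v) ≈ formal (map zʷ (stuffles u v))
  η-∗-η u v t = begin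
    coeff (ι (η u ∗ η v)) t                  ≡⟨ coeff≈pair (ι (η u ∗ η v)) t ⟩
    ⟪ δ t ∣ ι (η u ∗ η v) ⟫                  ≡⟨ pair-mapBasis (δ t) zʷ (η u ∗ η v) ⟩
    ⟪ δ t ∘ zʷ ∣ η u ∗ η v ⟫                 ≡⟨ pair-bilinear-η (δ t ∘ zʷ) _∗ʷ_ u v ⟩
    ⟪ δ t ∘ zʷ ∣ u ∗ʷ v ⟫                    ≡⟨ cong ⟪ δ t ∘ zʷ ∣_⟫ (∗ʷ-formal u v) ⟩
    ⟪ δ t ∘ zʷ ∣ formal (stuffles u v) ⟫     ≡⟨ pair-mapBasis (δ t) zʷ (formal (stuffles u v)) ⟨
    ⟪ δ t ∣ ι (formal (stuffles u v)) ⟫      ≡⟨ cong ⟪ δ t ∣_⟫ (formal-map zʷ (stuffles u v)) ⟩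
    ⟪ δ t ∣ formal (map zʷ (stuffles u v)) ⟫ ≡⟨ coeff≈pair (formal (map zʷ (stuffles u v))) t ⟨
    coeff (formal (map zʷ (stuffles u v))) t ∎

  η-ш-η : ∀ u v → η u ш η v ≈ formal (shuffles u v)
  η-ш-η u v t = begin
    coeff (η u ш η v) t              ≡⟨ coeff≈pair (η u ш η v) t ⟩
    ⟪ δ t ∣ η u ш η v ⟫              ≡⟨ pair-bilinear-η (δ t) _шʷ_ u v ⟩
    ⟪ δ t ∣ u шʷ v ⟫                 ≡⟨ cong ⟪ δ t ∣_⟫ (шʷ-formal u v) ⟩
    ⟪ δ t ∣ formal (shuffles u v) ⟫  ≡⟨ coeff≈pair (formal (shuffles u v)) t ⟨
    coeff (formal (shuffles u v)) t  ∎

  formal-↭ : ∀ {L M} → L ↭ M → formal L ≈ formal M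
  formal-↭ ↭.refl t            = refl
  formal-↭ (↭.prep w L↭M) t    = cong (δ t w ℚ.+_) (formal-↭ L↭M t)
  formal-↭ (↭.swap {L} {M} v w L↭M) t = begin
    a ℚ.+ (b ℚ.+ coeff (formal L) t)   ≡⟨ cong (λ c → a ℚ.+ (b ℚ.+ c)) (formal-↭ L↭M t) ⟩
    a ℚ.+ (b ℚ.+ coeff (formal M) t)   ≡⟨ x∙yz≈y∙xz a b _ ⟩
    b ℚ.+ (a ℚ.+ coeff (formal M) t)   ∎
    where
    open import Algebra.Properties.CommutativeSemigroup
      (CommutativeRing.+-commutativeSemigroup ℚ.+-*-commutativeRing) using (x∙yz≈y∙xz)
    a b : ℚ
    a = δ t v
    b = δ t w
  formal-↭ (↭.trans L↭M M↭N) t = trans (formal-↭ L↭M t) (formal-↭ M↭N t)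

  yш¹ : yш^ 1 ≈ η [ y ]
  yш¹ t = η-ш-η [ y ] [] t

  ш-yш¹ : ∀ v → η v ш yш^ 1 ≈ formal (shuffles [ y ] v)
  ш-yш¹ v t = begin
    coeff (η v ш yш^ 1) t               ≡⟨ ш-congˡ (η v) {yш^ 1} {η [ y ]} yш¹ t ⟩
    coeff (η v ш η [ y ]) t             ≡⟨ η-ш-η v [ y ] t ⟩
    coeff (formal (shuffles v [ y ])) t ≡⟨ formal-↭ (shuffles-comm v [ y ]) t ⟩
    coeff (formal (shuffles [ y ] v)) t ∎

  -- Both z₁ ∗ z_𝐥 and z₁ ш z_𝐥 begin with z₁z_𝐥, their only term outside 𝔥⁰; it
  -- cancels in the difference.
  common : Index → ℕ
  common (1 ∷ _) = 1
  common _       = 0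

  ds⁺ ds⁻ : Index → Index → List Index
  ds⁺ 𝐤 𝐥 = drop (common 𝐤) (stuffles 𝐤 𝐥)
  ds⁻ 𝐤 𝐥 = map decode (drop (common 𝐤) (shuffles (zʷ 𝐤) (zʷ 𝐥)))

  ds : Index → Index → 𝔥
  ds 𝐤 𝐥 = formal (map zʷ (ds⁺ 𝐤 𝐥)) ⊖ formal (map zʷ (ds⁻ 𝐤 𝐥))

  -- Covers both kinds at once, as (3), (2,1) and (2) are themselves admissible.
  data Pair (k : ℕ) : Index → Index → Set where
    adm : ∀ {i j 𝐤 𝐥} → Adm i 𝐤 → Adm j 𝐥 → i + j ≡ k → Pair k 𝐤 𝐥
    [1] : ∀ {j 𝐥} → Adm j 𝐥 → 1 + j ≡ k → Pair k [ 1 ] 𝐥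

  decode-adm : ∀ {n L} → All (H⁰ n) L → All (Adm n) (map decode L)
  decode-adm = All.map⁺ ∘ All.map (proj₁ ∘ decode-H⁰)

  zʷ-decode : ∀ {n L} → All (H⁰ n) L → map zʷ (map decode L) ≡ L
  zʷ-decode []      = refl
  zʷ-decode (h ∷ H) = cong₂ _∷_ (proj₂ (decode-H⁰ h)) (zʷ-decode H)

  𝔥⁰-formal : ∀ {n L} → All (H⁰ n) L → 𝔥⁰ (formal L)
  𝔥⁰-formal []               = 𝔥⁰-𝟘
  𝔥⁰-formal {L = w ∷ L} (h ∷ H) = 𝔥⁰-⊕ {η w} {formal L} (𝔥⁰-η h) (𝔥⁰-formal H)

  zʷ-all : ∀ {n L} → All (Adm n) L → All (H⁰ n) (map zʷ L)
  zʷ-all = All.map⁺ ∘ All.map zʷ-H⁰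

  common-adm : ∀ {n 𝐤} → Adm n 𝐤 → common 𝐤 ≡ 0
  common-adm (∅ , _)               = refl
  common-adm (s≤s (s≤s _) ∷ _ , _) = refl

  ds⁺-adm : ∀ {k 𝐤 𝐥} → Pair k 𝐤 𝐥 → All (Adm k) (ds⁺ 𝐤 𝐥)
  ds⁺-adm (adm 𝐤-adm 𝐥-adm refl) rewrite common-adm 𝐤-adm = stuffles-adm 𝐤-adm 𝐥-adm
  ds⁺-adm ([1] 𝐥-adm refl) = stuffles-1 𝐥-adm

  ds⁻-words : ∀ {k 𝐤 𝐥} → Pair k 𝐤 𝐥 → All (H⁰ k) (drop (common 𝐤) (shuffles (zʷ 𝐤) (zʷ 𝐥)))
  ds⁻-words (adm 𝐤-adm 𝐥-adm refl) rewrite common-adm 𝐤-adm =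
    shuffles-H⁰ (zʷ-H⁰ 𝐤-adm) (zʷ-H⁰ 𝐥-adm)
  ds⁻-words ([1] 𝐥-adm refl) = shuffles-y (zʷ-H⁰ 𝐥-adm)

  ds⁻-adm : ∀ {k 𝐤 𝐥} → Pair k 𝐤 𝐥 → All (Adm k) (ds⁻ 𝐤 𝐥)
  ds⁻-adm = decode-adm ∘ ds⁻-words

  regularizes-𝔥⁰ : ∀ {w a} → 𝔥⁰ a → w ≈ a → Regularizes w a
  regularizes-𝔥⁰ {w} {a} reg-𝔥⁰ w≈a = record
    { rest = 𝟘 ; reg-𝔥⁰ = reg-𝔥⁰ ; rest-𝔥⁰ = 𝔥⁰-𝟘
    ; decomp = λ t → trans (w≈a t) (cong (λ p → coeff p t) (sym (List.++-identityʳ a))) }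

  stuffles-[1] : ∀ 𝐥 → stuffles [ 1 ] 𝐥 ≡ (1 ∷ 𝐥) ∷ ds⁺ [ 1 ] 𝐥
  stuffles-[1] []      = refl
  stuffles-[1] (_ ∷ _) = refl

  shuffles-[y] : ∀ v → shuffles [ y ] v ≡ (y ∷ v) ∷ drop 1 (shuffles [ y ] v)
  shuffles-[y] []      = refl
  shuffles-[y] (_ ∷ _) = refl

  record RegularizedPair (𝐤 𝐥 : Index) : Set where
    field
      {reg∗ regш} : 𝔥
      ∗-reg : Regularizes (ι (η 𝐤 ∗ η 𝐥)) reg∗
      ш-reg : Regularizes (η (zʷ 𝐤) ш η (zʷ 𝐥)) regш
      diff  : reg∗ ⊖ regш ≈ ds 𝐤 𝐥

  regularizedPair : ∀ {k 𝐤 𝐥} → Pair k 𝐤 𝐥 → RegularizedPair 𝐤 𝐥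
  regularizedPair {k} {𝐤} {𝐥} pr@(adm 𝐤-adm 𝐥-adm refl) = record
    { ∗-reg = regularizes-𝔥⁰ {a = formal (map zʷ (ds⁺ 𝐤 𝐥))} (𝔥⁰-formal (zʷ-all (ds⁺-adm pr)))
        (subst (λ n → ι (η 𝐤 ∗ η 𝐥) ≈ formal (map zʷ (drop n (stuffles 𝐤 𝐥))))
          (sym (common-adm 𝐤-adm)) (η-∗-η 𝐤 𝐥))
    ; ш-reg = regularizes-𝔥⁰ {a = formal (map zʷ (ds⁻ 𝐤 𝐥))} (𝔥⁰-formal (zʷ-all (ds⁻-adm pr)))
        (subst (λ L → η (zʷ 𝐤) ш η (zʷ 𝐥) ≈ formal L)
          (sym (trans (zʷ-decode (ds⁻-words pr))
                      (cong (λ n → drop n (shuffles (zʷ 𝐤) (zʷ 𝐥))) (common-adm 𝐤-adm))))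
          (η-ш-η (zʷ 𝐤) (zʷ 𝐥)))
    ; diff = λ _ → refl }
  regularizedPair {𝐥 = 𝐥} pr@([1] 𝐥-adm refl) = record
    -- The shuffle z₁ ш z_𝐥 is z_𝐥 ш y, a pure degree-1 term, so it regularizes to 0. Subtracting
    -- z_𝐥 ш y = z₁z_𝐥 + Q from z₁ ∗ z_𝐥 = z₁z_𝐥 + P leaves P - Q in 𝔥⁰.
    { reg∗ = P ⊖ Q ; regш = 𝟘
    ; ∗-reg = record
      { rest = η l
      ; reg-𝔥⁰ = 𝔥⁰-⊖ {P} {Q} (𝔥⁰-formal (zʷ-all (ds⁺-adm pr))) (𝔥⁰-formal (zʷ-all (ds⁻-adm pr)))
      ; rest-𝔥⁰ = 𝔥⁰-η (zʷ-H⁰ 𝐥-adm) ; decomp = decomp∗ }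
    ; ш-reg = record
      { rest = η l ; reg-𝔥⁰ = 𝔥⁰-𝟘 ; rest-𝔥⁰ = 𝔥⁰-η (zʷ-H⁰ 𝐥-adm)
      ; decomp = λ t → trans (η-ш-η [ y ] l t) (sym (ш-yш¹ l t)) }
    ; diff = λ t → trans (coeff-⊖ (P ⊖ Q) 𝟘 t) (ℚ.+-identityʳ _)
    }
    where
    l : Word
    l = zʷ 𝐥
    P Q : 𝔥
    P = formal (map zʷ (ds⁺ [ 1 ] 𝐥))
    Q = formal (map zʷ (ds⁻ [ 1 ] 𝐥))
    decomp∗ : ι (η [ 1 ] ∗ η 𝐥) ≈ (P ⊖ Q) ⊕ η l ш yш^ 1
    decomp∗ t = begin
      coeff (ι (η [ 1 ] ∗ η 𝐥)) t
        ≡⟨ η-∗-η [ 1 ] 𝐥 t ⟩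
      coeff (formal (map zʷ (stuffles [ 1 ] 𝐥))) t
        ≡⟨ cong (λ L → coeff (formal (map zʷ L)) t) (stuffles-[1] 𝐥) ⟩
      N ℚ.+ coeff P t
        ≡⟨ solve 3 (λ N P Q → N :+ P := (P :- Q) :+ (N :+ Q)) refl N (coeff P t) (coeff Q t) ⟩
      (coeff P t ℚ.- coeff Q t) ℚ.+ (N ℚ.+ coeff Q t)
        ≡⟨ cong₂ ℚ._+_ (sym (coeff-⊖ P Q t))
                       (cong (λ L → N ℚ.+ coeff (formal L) t) (zʷ-decode (ds⁻-words pr))) ⟩
      coeff (P ⊖ Q) t ℚ.+ coeff (formal ((y ∷ l) ∷ drop 1 (shuffles [ y ] l))) t
        ≡⟨ cong (λ L → coeff (P ⊖ Q) t ℚ.+ coeff (formal L) t) (shuffles-[y] l) ⟨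
      coeff (P ⊖ Q) t ℚ.+ coeff (formal (shuffles [ y ] l)) t
        ≡⟨ cong (coeff (P ⊖ Q) t ℚ.+_) (ш-yш¹ l t) ⟨
      coeff (P ⊖ Q) t ℚ.+ coeff (η l ш yш^ 1) t
        ≡⟨ coeff-⊕ (P ⊖ Q) (η l ш yш^ 1) t ⟨
      coeff ((P ⊖ Q) ⊕ η l ш yш^ 1) t ∎
      where
      N : ℚ
      N = δ t (y ∷ l)

  isDs : ∀ {k 𝐤 𝐥 w} → Pair k 𝐤 𝐥 → w ≈ ds 𝐤 𝐥 → IsDs 𝐤 𝐥 w
  isDs pr w≈ds = reg∗ , regш , isReg ∗-reg , isReg ш-reg , λ t → trans (w≈ds t) (sym (diff t))
    where open RegularizedPair (regularizedPair pr)

  isDs-unique : ∀ {k 𝐤 𝐥 w} → Pair k 𝐤 𝐥 → IsDs 𝐤 𝐥 w → w ≈ ds 𝐤 𝐥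
  isDs-unique {𝐤 = 𝐤} {𝐥} {w} pr (v , v′ , v-reg , v′-reg , w≈) t = begin
    coeff w t                      ≡⟨ w≈ t ⟩
    coeff (v ⊖ v′) t               ≡⟨ coeff-⊖ v v′ t ⟩
    coeff v t ℚ.- coeff v′ t       ≡⟨ cong₂ ℚ._-_ (isReg-unique {v = v} ∗-reg v-reg t)
                                                  (isReg-unique {v = v′} ш-reg v′-reg t) ⟩
    coeff reg∗ t ℚ.- coeff regш t  ≡⟨ coeff-⊖ reg∗ regш t ⟨
    coeff (reg∗ ⊖ regш) t          ≡⟨ diff t ⟩
    coeff (ds 𝐤 𝐥) t               ∎
    where open RegularizedPair (regularizedPair pr)

-- Reduction modulo 2

adm? : ∀ k t → Dec (Adm k t)
adm? k t = admissible? t ×-dec (sum t ℕ.≟ k)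

-- The proof stored in a refinement is irrelevant and cannot be matched on; decidability recovers a
-- usable one.
value-adm : ∀ {k} (𝐦 : 𝐈 k) → Adm k (value 𝐦)
value-adm {k} (t , irr t-adm) = recompute (adm? k t) t-adm

zʷ∘value-injective : ∀ {k} → Injective _≡_ _≡_ (zʷ ∘ value {P = Adm k})
zʷ∘value-injective {k} {𝐦} {𝐧} eq = value-injective (begin
  value 𝐦                ≡⟨ decode-zʷ (pos 𝐦) ⟨
  decode (zʷ (value 𝐦))  ≡⟨ cong decode eq ⟩
  decode (zʷ (value 𝐧))  ≡⟨ decode-zʷ (pos 𝐧) ⟩
  value 𝐧                ∎)
  where
  open ≡-Reasoning
  pos : (𝐦 : 𝐈 k) → Pos (value 𝐦)
  pos = adm⇒pos ∘ proj₁ ∘ value-adm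

module _ {k : ℕ} where
  open Freeℚ.Equality _≟ʷ_ using () renaming (_≈_ to _≈ℚ_; coeff to coeffℚ)
  open Freeℤ.Equality (_≟ᴵ_ {k}) using () renaming (coeff to coeffℤ)
  open Linear𝓗ᵇ k using () renaming (_≈_ to _≈₂_; coeff to coeff₂)

  -- Rational coefficients at encoded words determine the integer coefficients, since ℤ embeds in ℚ
  -- and distinct indices have distinct words; their parities then agree.
  canᵇ-cong : ∀ d d′ → ⟦ d ⟧ ≈ℚ ⟦ d′ ⟧ → canᵇ d ≈₂ canᵇ d′
  canᵇ-cong d d′ d≈d′ 𝐦 = begin
    coeff₂ (canᵇ d) 𝐦         ≡⟨ mod2 d ⟩
    parity ∣ coeffℤ d 𝐦 ∣     ≡⟨ cong (parity ∘ ∣_∣) same ⟩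
    parity ∣ coeffℤ d′ 𝐦 ∣    ≡⟨ mod2 d′ ⟨
    coeff₂ (canᵇ d′) 𝐦        ∎
    where
    open ≡-Reasoning
    toℚ : ∀ d → coeffℚ ⟦ d ⟧ (zʷ (value 𝐦)) ≡ coeffℤ d 𝐦 / 1
    toℚ d = coeff-transfer ℤ.+-*-commutativeRing ℚ.+-*-commutativeRing (_/ 1) refl /1-homo-+
      _≟ᴵ_ _≟ʷ_ (zʷ ∘ value) zʷ∘value-injective d 𝐦
    same : coeffℤ d 𝐦 ≡ coeffℤ d′ 𝐦
    same = /1-injective {coeffℤ d 𝐦} {coeffℤ d′ 𝐦}
      (trans (sym (toℚ d)) (trans (d≈d′ (zʷ (value 𝐦))) (toℚ d′)))
    mod2 : ∀ d → coeff₂ (canᵇ d) 𝐦 ≡ parity ∣ coeffℤ d 𝐦 ∣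
    mod2 d = coeff-transfer ℤ.+-*-commutativeRing ℙ.+-*-commutativeRing (parity ∘ ∣_∣) refl parity-+
      _≟ᴵ_ _≟ᴵ_ (λ 𝐦 → 𝐦) (λ eq → eq) d 𝐦

∈-reduce : {A B : Set} {P : A → Set} (f : ∀ {a} → P a → B) →
           {L : List A} (ps : All P L) {a : A} (a∈ : a ∈ L) →
           f (All.lookup ps a∈) ∈ All.reduce f ps
∈-reduce f (p ∷ ps) (here refl) = here refl
∈-reduce f (p ∷ ps) (there a∈)  = there (∈-reduce f ps a∈)

all-reduce : {A B : Set} {P : A → Set} {Q : B → Set} (f : ∀ {a} → P a → B) →
             (∀ {a} (p : P a) → Q (f p)) → {L : List A} (ps : All P L) → All Q (All.reduce f ps)
all-reduce f q []       = []
all-reduce f q (p ∷ ps) = q p ∷ all-reduce f q ps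

refine : ∀ {k L} → All (Adm k) L → List (𝐈 k)
refine = All.reduce (λ {t} t-adm → t , irr t-adm)

total : (Index → Parity) → List Index → Parity
total φ = foldr (λ t s → φ t ℙ.+ s) 0ℙ

module _ {k 𝐤 𝐥} (pr : Pair k 𝐤 𝐥) where
  open Freeℤ using (_⊖_; _·_)
  open Pairing ℤ.+-*-commutativeRing using () renaming (formal to formalℤ)
  open Pairing ℚ.+-*-commutativeRing using (formal)
  open Pairing ℙ.+-*-commutativeRing using (⟪_∣_⟫; pair-⊕)

  -- The integral lift that `Generator` asks for, with weight and admissibility certified term by
  -- term.
  dsℤ : Freeℤ.Free (𝐈 k)
  dsℤ = formalℤ (refine (ds⁺-adm pr)) ⊖ formalℤ (refine (ds⁻-adm pr))

  ⟦dsℤ⟧ : ⟦ dsℤ ⟧ ≡ ds 𝐤 𝐥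
  ⟦dsℤ⟧ = trans (List.map-++ _ (formalℤ (refine (ds⁺-adm pr))) _)
    (cong₂ _++_ (plus (ds⁺-adm pr)) (minus (ds⁻-adm pr)))
    where
    plus : ∀ {L} (as : All (Adm k) L) → ⟦ formalℤ (refine as) ⟧ ≡ formal (map zʷ L)
    plus []       = refl
    plus (a ∷ as) = cong (_ ∷_) (plus as)
    minus : ∀ {L} (as : All (Adm k) L) →
      ⟦ ℤ.-1ℤ · formalℤ (refine as) ⟧ ≡ (ℚ.- 1ℚ) Freeℚ.· formal (map zʷ L)
    minus []       = refl
    minus (a ∷ as) = cong (_ ∷_) (minus as)

  -- The coefficient -1 is odd, so the shuffle half enters with a plus. The right side is free of
  -- proofs and rationals and can be evaluated.
  pair-dsℤ : ∀ φ → ⟪ φ ∘ value ∣ canᵇ dsℤ ⟫ ≡ total φ (ds⁺ 𝐤 𝐥) ℙ.+ total φ (ds⁻ 𝐤 𝐥)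
  pair-dsℤ φ = trans (cong ⟪ φ ∘ value ∣_⟫ (List.map-++ _ (formalℤ (refine (ds⁺-adm pr))) _))
    (trans (pair-⊕ (φ ∘ value) (canᵇ (formalℤ (refine (ds⁺-adm pr)))) _)
           (cong₂ ℙ._+_ (plus (ds⁺-adm pr)) (minus (ds⁻-adm pr))))
    where
    plus : ∀ {L} (as : All (Adm k) L) → ⟪ φ ∘ value ∣ canᵇ (formalℤ (refine as)) ⟫ ≡ total φ L
    plus []               = refl
    plus {t ∷ _} (a ∷ as) = cong (φ t ℙ.+_) (plus as)
    minus : ∀ {L} (as : All (Adm k) L) →
      ⟪ φ ∘ value ∣ canᵇ (ℤ.-1ℤ · formalℤ (refine as)) ⟫ ≡ total φ L
    minus []               = refl
    minus {t ∷ _} (a ∷ as) = cong (φ t ℙ.+_) (minus as)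

  isDs-dsℤ : IsDs 𝐤 𝐥 ⟦ dsℤ ⟧
  isDs-dsℤ = isDs {w = ⟦ dsℤ ⟧} pr λ t → cong (λ w → coeffℚ w t) ⟦dsℤ⟧
    where open Freeℚ.Equality _≟ʷ_ using () renaming (coeff to coeffℚ)

  canᵇ-unique : ∀ d → IsDs 𝐤 𝐥 ⟦ d ⟧ → Linear𝓗ᵇ._≈_ k (canᵇ d) (canᵇ dsℤ)
  canᵇ-unique d d-isDs = canᵇ-cong d dsℤ λ t →
    trans (isDs-unique {w = ⟦ d ⟧} pr d-isDs t) (cong (λ w → coeffℚ w t) (sym ⟦dsℤ⟧))
    where open Freeℚ.Equality _≟ʷ_ using () renaming (coeff to coeffℚ)

-- Enumeration of the indices of a given weight

words¹ : ℕ → List Word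
words¹ zero          = [ [] ]
words¹ (suc zero)    = [ [ y ] ]
words¹ (suc (suc n)) = map (x ∷_) (words¹ (suc n)) ++ map (y ∷_) (words¹ (suc n))

-- For `n` at least 2 these are the words of length `n` from x to y, with n - 2 free letters in
-- between.
indices : ℕ → List Index
indices zero          = [ [] ]
indices (suc zero)    = []
indices (suc (suc n)) = map (decode ∘ (x ∷_)) (words¹ (suc n))

words¹-complete : ∀ {n w} → H¹ n w → w ∈ words¹ n
words¹-complete []                    = here refl
words¹-complete {suc zero}    (y∷ []) = here refl
words¹-complete {suc (suc n)} (y∷ h)  =
  ∈-++⁺ʳ (map (x ∷_) (words¹ (suc n))) (∈-map⁺ (y ∷_) (words¹-complete h))
words¹-complete {suc (suc n)} (x∷ h)  = ∈-++⁺ˡ (∈-map⁺ (x ∷_) (words¹-complete h))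

words¹-sound : ∀ n → All (H¹ n) (words¹ n)
words¹-sound zero          = [] ∷ []
words¹-sound (suc zero)    = (y∷ []) ∷ []
words¹-sound (suc (suc n)) =
  All.++⁺ (cons-all x (words¹-sound (suc n))) (cons-all y (words¹-sound (suc n)))

indices-complete : ∀ {n t} → Adm n t → t ∈ indices n
indices-complete {n} {t} t-adm =
  subst (_∈ indices n) (decode-zʷ (adm⇒pos (proj₁ t-adm))) (go (zʷ-H⁰ t-adm))
  where
  go : ∀ {w n} → H⁰ n w → decode w ∈ indices n
  go []     = here refl
  go (x∷ h) = ∈-map⁺ (decode ∘ (x ∷_)) (words¹-complete h)

indices-sound : ∀ n → All (Adm n) (indices n)
indices-sound zero          = (∅ , refl) ∷ []
indices-sound (suc zero)    = []
indices-sound (suc (suc n)) = All.map⁺ (All.map (proj₁ ∘ decode-H⁰ ∘ x∷_) (words¹-sound (suc n)))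

-- Weight 7

toPair : ∀ • {k 𝐤 𝐥} → PI • k 𝐤 𝐥 → Pair k 𝐤 𝐥
toPair KNT  ([3] 𝐥 e)   = adm (s≤s (s≤s z≤n) ∷ [] , refl) (value-adm 𝐥) e
toPair KNT  ([2,1] 𝐥 e) = adm (s≤s (s≤s z≤n) ∷ s≤s z≤n ∷ [] , refl) (value-adm 𝐥) e
toPair KNT  ([2] 𝐥 e)   = adm (s≤s (s≤s z≤n) ∷ [] , refl) (value-adm 𝐥) e
toPair KNT  ([1] 𝐥 e)   = [1] (value-adm 𝐥) e
toPair MJPO (adm 𝐤 𝐥 e) = adm (value-adm 𝐤) (value-adm 𝐥) e
toPair MJPO ([1] 𝐥 e)   = [1] (value-adm 𝐥) e

split : ℕ → List Index × List Index
split i = indices i , indices (7 ∸ i)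

blocks : Kind → List (List Index × List Index)
blocks KNT  = ((3 ∷ []) ∷ [] , indices 4) ∷ ((2 ∷ 1 ∷ []) ∷ [] , indices 4)
            ∷ ((2 ∷ []) ∷ [] , indices 5) ∷ ((1 ∷ []) ∷ [] , indices 6) ∷ []
-- The left weight runs from 0 to 7 inclusive; at both ends one component is the empty index.
blocks MJPO = ((1 ∷ []) ∷ [] , indices 6) ∷ map split (upTo 8)

pairs : Kind → List (Index × Index)
pairs • = concatMap (uncurry cartesianProduct) (blocks •)

∈-pairs : ∀ • {𝐤 𝐥} → Any (λ (K , L) → 𝐤 ∈ K × 𝐥 ∈ L) (blocks •) → (𝐤 , 𝐥) ∈ pairs •
∈-pairs • = ∈-concatMap⁺ (uncurry cartesianProduct) ∘ Any.map (uncurry ∈-cartesianProduct⁺)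

value∈indices : ∀ {k} (𝐦 : 𝐈 k) → value 𝐦 ∈ indices k
value∈indices = indices-complete ∘ value-adm

pairs-complete : ∀ • {𝐤 𝐥} → PI • 7 𝐤 𝐥 → (𝐤 , 𝐥) ∈ pairs •
pairs-complete KNT  ([3] 𝐥 refl)   = ∈-pairs KNT (here (here refl , value∈indices 𝐥))
pairs-complete KNT  ([2,1] 𝐥 refl) = ∈-pairs KNT (there (here (here refl , value∈indices 𝐥)))
pairs-complete KNT  ([2] 𝐥 refl)   = ∈-pairs KNT (there (there (here (here refl , value∈indices 𝐥))))
pairs-complete KNT  ([1] 𝐥 refl)   = ∈-pairs KNT (there (there (there (here (here refl , value∈indices 𝐥)))))
pairs-complete MJPO ([1] 𝐥 refl)   = ∈-pairs MJPO (here (here refl , value∈indices 𝐥))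
pairs-complete MJPO (adm {i} {j} 𝐤 𝐥 e) = ∈-pairs MJPO (there (Any.map⁺ {f = split} (Any.map
  (λ { refl → value∈indices 𝐤 , subst (λ j → value 𝐥 ∈ indices j) j≡7∸i (value∈indices 𝐥) })
  (∈-upTo⁺ (s≤s (subst (i ≤_) e (ℕ.m≤m+n i j)))))))
  where
  j≡7∸i : j ≡ 7 ∸ i
  j≡7∸i = trans (sym (ℕ.m+n∸m≡n i j)) (cong (_∸ i) e)

toIndex : ∀ k {t} → t ∈ indices k → 𝐈 k
toIndex k {t} t∈ = t , irr (All.lookup (indices-sound k) t∈)

blocks-sound : ∀ • → All (λ (K , L) → ∀ {𝐤 𝐥} → 𝐤 ∈ K → 𝐥 ∈ L → PI • 7 𝐤 𝐥) (blocks •)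
blocks-sound KNT  = (λ { (here refl) 𝐥∈ → [3] (toIndex 4 𝐥∈) refl })
                  ∷ (λ { (here refl) 𝐥∈ → [2,1] (toIndex 4 𝐥∈) refl })
                  ∷ (λ { (here refl) 𝐥∈ → [2] (toIndex 5 𝐥∈) refl })
                  ∷ (λ { (here refl) 𝐥∈ → [1] (toIndex 6 𝐥∈) refl }) ∷ []
blocks-sound MJPO = (λ { (here refl) 𝐥∈ → [1] (toIndex 6 𝐥∈) refl })
                  ∷ All.map⁺ {f = split} (All.tabulate λ {i} i∈ 𝐤∈ 𝐥∈ →
                      adm (toIndex i 𝐤∈) (toIndex (7 ∸ i) 𝐥∈)
                          (ℕ.m+[n∸m]≡n (ℕ.≤-pred (∈-upTo⁻ i∈))))

pairs-sound : ∀ • {𝐤 𝐥} → (𝐤 , 𝐥) ∈ pairs • → PI • 7 𝐤 𝐥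
pairs-sound • {𝐤} {𝐥} ∈pairs with find (∈-concatMap⁻ (uncurry cartesianProduct) ∈pairs)
... | (K , L) , KL∈ , ∈K×L =
  uncurry (All.lookup (blocks-sound •) KL∈) (∈-cartesianProduct⁻ K L ∈K×L)

indicator : List Index → Index → Parity
indicator L t = if does (Any.any? (List.≡-dec ℕ._≟_ t) L) then 1ℙ else 0ℙ

-- A basis of the annihilator of 𝓔ᵇ₇, found by row reduction.
φ₀ φ₁ φ₂ φ₃ : Index → Parity
φ₀ _ = 1ℙ
φ₁ = indicator
  ( (2 ∷ 1 ∷ 2 ∷ 2 ∷ []) ∷ (2 ∷ 2 ∷ 2 ∷ 1 ∷ []) ∷ (2 ∷ 2 ∷ 3 ∷ []) ∷ (2 ∷ 4 ∷ 1 ∷ [])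
  ∷ (3 ∷ 1 ∷ 1 ∷ 2 ∷ []) ∷ (3 ∷ 2 ∷ 1 ∷ 1 ∷ []) ∷ (3 ∷ 2 ∷ 2 ∷ []) ∷ (4 ∷ 2 ∷ 1 ∷ []) ∷ [] )
φ₂ = indicator
  ( (2 ∷ 1 ∷ 1 ∷ 3 ∷ []) ∷ (2 ∷ 1 ∷ 2 ∷ 2 ∷ []) ∷ (2 ∷ 1 ∷ 4 ∷ []) ∷ (2 ∷ 2 ∷ 1 ∷ 2 ∷ [])
  ∷ (2 ∷ 2 ∷ 3 ∷ []) ∷ (2 ∷ 3 ∷ 1 ∷ 1 ∷ []) ∷ (2 ∷ 3 ∷ 2 ∷ []) ∷ (2 ∷ 4 ∷ 1 ∷ [])
  ∷ (3 ∷ 1 ∷ 1 ∷ 2 ∷ []) ∷ (3 ∷ 1 ∷ 2 ∷ 1 ∷ []) ∷ (3 ∷ 3 ∷ 1 ∷ []) ∷ (4 ∷ 1 ∷ 2 ∷ []) ∷ [] )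
φ₃ = indicator
  ( (2 ∷ 1 ∷ 2 ∷ 2 ∷ []) ∷ (2 ∷ 1 ∷ 3 ∷ 1 ∷ []) ∷ (2 ∷ 2 ∷ 1 ∷ 2 ∷ []) ∷ (2 ∷ 2 ∷ 2 ∷ 1 ∷ [])
  ∷ (2 ∷ 2 ∷ 3 ∷ []) ∷ (2 ∷ 3 ∷ 2 ∷ []) ∷ (3 ∷ 1 ∷ 2 ∷ 1 ∷ []) ∷ (3 ∷ 1 ∷ 3 ∷ [])
  ∷ (3 ∷ 2 ∷ 2 ∷ []) ∷ (3 ∷ 3 ∷ 1 ∷ []) ∷ (4 ∷ 1 ∷ 1 ∷ 1 ∷ []) ∷ (5 ∷ 1 ∷ 1 ∷ []) ∷ [] )

functionals : List (Index → Parity)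
functionals = φ₀ ∷ φ₁ ∷ φ₂ ∷ φ₃ ∷ []

pairing : Index × Index → (Index → Parity) → Parity
pairing (𝐤 , 𝐥) φ = total φ (ds⁺ 𝐤 𝐥) ℙ.+ total φ (ds⁻ 𝐤 𝐥)

pairing-vanishes : All (λ 𝐤𝐥 → All (λ φ → pairing 𝐤𝐥 φ ≡ 0ℙ) functionals) (pairs MJPO)
pairing-vanishes = toWitness
  {a? = All.all? (λ 𝐤𝐥 → All.all? (λ φ → pairing 𝐤𝐥 φ ℙ.≟ 0ℙ) functionals) (pairs MJPO)} tt

-- The dimension in weight 7

open Free𝔽₂ using (η)
open Linear𝓗ᵇ 7 using (coeff; LinearlyIndependent)
open Pairing ℙ.+-*-commutativeRing
open Coeff (_≟ᴵ_ {7}) using (pair-≈)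

indices₇ : List (𝐈 7)
indices₇ = refine (indices-sound 7)

indices₇-complete : ∀ 𝐦 → 𝐦 ∈ indices₇
indices₇-complete 𝐦 =
  ∈-reduce (λ {t} t-adm → t , irr t-adm) (indices-sound 7) (value∈indices 𝐦)

open FiniteDimensional (_≟ᴵ_ {7}) indices₇ indices₇-complete

-- Every KNT pair is also an MJPO pair, so the single evaluation in `pairing-vanishes` serves both
-- kinds.
pairs⊆MJPO : ∀ • {𝐤 𝐥} → PI • 7 𝐤 𝐥 → (𝐤 , 𝐥) ∈ pairs MJPO
pairs⊆MJPO • π with toPair • π
... | adm 𝐤-adm 𝐥-adm e = pairs-complete MJPO (adm (_ , irr 𝐤-adm) (_ , irr 𝐥-adm) e)
... | [1] 𝐥-adm e       = pairs-complete MJPO ([1] (_ , irr 𝐥-adm) e)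

functional-vanishes : ∀ • {φ p} → φ ∈ functionals → Generator • 7 p → ⟪ φ ∘ value ∣ p ⟫ ≡ 0ℙ
functional-vanishes • {φ} φ∈ (generator {𝐤} {𝐥} π d d-isDs) = begin
  ⟪ φ ∘ value ∣ canᵇ d ⟫
    ≡⟨ pair-≈ (φ ∘ value) {canᵇ d} {canᵇ (dsℤ pr)} (canᵇ-unique pr d d-isDs) ⟩
  ⟪ φ ∘ value ∣ canᵇ (dsℤ pr) ⟫
    ≡⟨ pair-dsℤ pr φ ⟩
  pairing (𝐤 , 𝐥) φ
    ≡⟨ All.lookup (All.lookup pairing-vanishes (pairs⊆MJPO • π)) φ∈ ⟩
  0ℙ ∎
  where
  open ≡-Reasoning
  pr : Pair 7 𝐤 𝐥
  pr = toPair • π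

module _ (• : Kind) where

  pairs-PI : All (uncurry (PI • 7)) (pairs •)
  pairs-PI = All.tabulate (pairs-sound •)

  dsᵇ : ∀ {𝐤𝐥} → uncurry (PI • 7) 𝐤𝐥 → 𝓗ᵇ 7
  dsᵇ π = canᵇ (dsℤ (toPair • π))

  generators : List (𝓗ᵇ 7)
  generators = All.reduce dsᵇ pairs-PI

  generators-sound : All (Generator • 7) generators
  generators-sound = all-reduce dsᵇ
    (λ π → generator π (dsℤ (toPair • π)) (isDs-dsℤ (toPair • π))) pairs-PI

  open Subbasis (subbasis generators)

  -- A generator may come from any integral lift, but all lifts for one pair agree modulo 2 with the
  -- listed `dsℤ`.
  generator-inSpan : ∀ {p} → Generator • 7 p → InSpan basis p
  generator-inSpan (generator π d d-isDs) with pairs-complete • π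
  ... | ∈pairs with All.lookup spans (∈-reduce dsᵇ pairs-PI ∈pairs)
  ... | c , dsᵇ≈ = c , λ 𝐦 →
    trans (canᵇ-unique (toPair • (All.lookup pairs-PI ∈pairs)) d d-isDs 𝐦) (dsᵇ≈ 𝐦)

  basis-generator : ∀ i → Generator • 7 (basis i)
  basis-generator i = All.lookup generators-sound (⊆gs i)

  dimension : dim𝓔ᵇ • , 7 ≡ size
  dimension = basis , record
    { inside      = λ i → 1 , (λ _ → 1ℙ) , (λ _ → basis i) , (λ _ → basis-generator i) , λ 𝐦 →
        sym (trans (lincomb-∷ (λ _ → 1ℙ) (λ (_ : Fin 1) → basis i) 𝐦)
                   (ℙ.+-identityʳ (coeff (basis i) 𝐦)))
    ; independent = independent
    ; spanning    = λ { p (m , c , g , g∈ , p≈) →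
        let (a , cg≈) = inSpan-lincomb c g (generator-inSpan ∘ g∈)
        in a , λ 𝐦 → trans (p≈ 𝐦) (cg≈ 𝐦) }
    }

  -- Four unit vectors are adjoined to `basis` one at a time; each new one is seen by a functional
  -- that vanishes on everything before it.
  size≤28 : size ≤ 28
  -- The length of `indices₇` evaluates to 32 = 4 + 28.
  size≤28 = ℕ.+-cancelˡ-≤ 4 size 28 (independent⇒≤ {b = b₃} indep₃)
    where
    φ⊥basis : ∀ {φ} → φ ∈ functionals → ∀ i → ⟪ φ ∘ value ∣ basis i ⟫ ≡ 0ℙ
    φ⊥basis φ∈ i = functional-vanishes • φ∈ (basis-generator i)

    literal : (t : Index) {_ : True (adm? 7 t)} → 𝐈 7
    literal t {t-adm} = t , irr (toWitness t-adm)

    -- φᵢ(eᵢ) = 1, and φⱼ(eᵢ) = 0 for j > i.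
    e₀ e₁ e₂ e₃ : 𝐈 7
    e₀ = literal (7 ∷ [])
    e₁ = literal (3 ∷ 2 ∷ 1 ∷ 1 ∷ [])
    e₂ = literal (2 ∷ 1 ∷ 1 ∷ 3 ∷ [])
    e₃ = literal (2 ∷ 1 ∷ 3 ∷ 1 ∷ [])

    b₀ : Vector (𝓗ᵇ 7) (1 + size)
    b₀ = η e₀ Vector.∷ basis
    b₁ : Vector (𝓗ᵇ 7) (2 + size)
    b₁ = η e₁ Vector.∷ b₀
    b₂ : Vector (𝓗ᵇ 7) (3 + size)
    b₂ = η e₂ Vector.∷ b₁
    b₃ : Vector (𝓗ᵇ 7) (4 + size)
    b₃ = η e₃ Vector.∷ b₂

    indep₀ : LinearlyIndependent b₀
    indep₀ = separated-∷ {b = basis} (φ₀ ∘ value) e₀ independent (φ⊥basis (here refl)) refl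

    indep₁ : LinearlyIndependent b₁
    indep₁ = separated-∷ {b = b₀} (φ₁ ∘ value) e₁ indep₀
      (λ { zero → refl ; (suc i) → φ⊥basis (there (here refl)) i }) refl

    indep₂ : LinearlyIndependent b₂
    indep₂ = separated-∷ {b = b₁} (φ₂ ∘ value) e₂ indep₁
      (λ { zero → refl ; (suc zero) → refl
         ; (suc (suc i)) → φ⊥basis (there (there (here refl))) i }) refl

    indep₃ : LinearlyIndependent b₃
    indep₃ = separated-∷ {b = b₂} (φ₃ ∘ value) e₃ indep₂
      (λ { zero → refl ; (suc zero) → refl ; (suc (suc zero)) → refl
         ; (suc (suc (suc i))) → φ⊥basis (there (there (there (here refl)))) i }) refl

open import Data.Integer.Base using (+_; _-_; _<_)

mainTheorem4 : (• : Kind) →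
    ∃[ k ] 2 ≤ k × k ≤ 22 ×
    (∃[ n ] (dim𝓔ᵇ • , k ≡ n) × (+ n < + (2 ^ (k ∸ 2)) - + d k))
-- The integer difference evaluates to 32 - 3 = 29, and 22 is 7 + 15.
mainTheorem4 • = 7 , s≤s (s≤s z≤n) , ℕ.m≤m+n 7 15 , _ , dimension • , ℤ.+<+ (s≤s (size≤28 •))
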